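{- Let $G$ be a connected graph of order $n$ with $k$ pendent vertices. Then $$SO(G)\leq \frac{(n-k-2)(n-k-1)^2}{\sqrt{2}}+k\sqrt{(n-1)^2+1}+(n-k-1)\sqrt{(n-1)^2+(n-k-1)^2},$$ with equality if and only if $G$ is isomorphic to the graph obtained by attaching $k$ pendent edges to a single vertex of the complete graph $K_{n-k}$.
   Context: All graphs are finite and simple. A pendent vertex is a vertex of degree $1$. For a graph $G$ with edge set $E(G)$ and vertex degrees $d_G(v)$, the Sombor index is $SO(G)=\sum_{uv\in E(G)}\sqrt{d_G(u)^2+d_G(v)^2}$. Attaching a pendent edge to a vertex $w$ means adding a new vertex adjacent only to $w$.
   Formalization: The formal theorem assumes n ≥ 3: for n = 2 the claim fails, since K_2 has k = 2 and the right-hand side is 0 while SO(K_2) = √2; the trivial one-vertex graph (n = 1) is also left out. -}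

module Defs where

open import Data.Nat using (ℕ; zero; suc; _+_; _*_; _∸_; _^_; _≡ᵇ_; _<ᵇ_)
open import Data.Bool using (Bool; true; false; _∧_; _∨_; not; if_then_else_)
open import Data.Bool.Properties using (∧-comm; ∨-comm)
open import Data.Fin using (Fin; toℕ)
open import Data.List using (List; []; _∷_; [_]; map; concatMap; allFin)
open import Data.Nat.ListAction using (sum)
open import Data.Product using (_×_; _,_; Σ)
open import Data.Integer using (+_)
open import Data.Rational using (ℚ; 0ℚ; _/_; _≤_) renaming (_+_ to _+ℚ_; _*_ to _*ℚ_)
open import Function.Bundles using (_↔_; Inverse)
open import Relation.Binary.PropositionalEquality using (_≡_; refl; cong; cong₂)

record Graph (n : ℕ) : Set where
  field
    adj    : Fin n → Fin n → Bool
    sym    : ∀ u v → adj u v ≡ adj v u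
    irrefl : ∀ v → adj v v ≡ false
open Graph public

deg : ∀ {n} → Graph n → Fin n → ℕ
deg {n} G v = sum (map (λ u → if adj G v u then 1 else 0) (allFin n))

pendentCount : ∀ {n} → Graph n → ℕ
pendentCount {n} G = sum (map (λ v → if deg G v ≡ᵇ 1 then 1 else 0) (allFin n))

data Walk {n} (G : Graph n) : Fin n → Fin n → Set where
  here : ∀ {u} → Walk G u u
  step : ∀ {u w v} → adj G u w ≡ true → Walk G w v → Walk G u v

Connected : ∀ {n} → Graph n → Set
Connected {n} G = ∀ (u v : Fin n) → Walk G u v

_≅_ : ∀ {n} → Graph n → Graph n → Set
_≅_ {n} G H = Σ (Fin n ↔ Fin n) λ f →
  ∀ u v → adj G u v ≡ adj H (Inverse.to f u) (Inverse.to f v)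

-- Real numbers of the form  Σ cᵢ √aᵢ  (cᵢ ∈ ℕ, aᵢ ∈ ℚ, aᵢ ≥ 0),
-- represented as lists of terms (cᵢ , aᵢ), compared via rational
-- lower / upper approximations of the square roots.

Term : Set
Term = ℕ × ℚ

RadSum : Set
RadSum = List Term

fromℕ : ℕ → ℚ
fromℕ m = (+ m) / 1

data Lower : RadSum → ℚ → Set where
  lnil  : Lower [] 0ℚ
  lcons : ∀ {c a ts y} (p : ℚ) → 0ℚ ≤ p → p *ℚ p ≤ a →
          Lower ts y → Lower ((c , a) ∷ ts) (fromℕ c *ℚ p +ℚ y)

data Upper : RadSum → ℚ → Set where
  unil  : Upper [] 0ℚ
  ucons : ∀ {c a ts y} (q : ℚ) → 0ℚ ≤ q → a ≤ q *ℚ q →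
          Upper ts y → Upper ((c , a) ∷ ts) (fromℕ c *ℚ q +ℚ y)

-- value(L) ≤ value(R)  (sup of lower approximations ≤ inf of upper ones)
_≤√_ : RadSum → RadSum → Set
L ≤√ R = ∀ x y → Lower L x → Upper R y → x ≤ y

_≈√_ : RadSum → RadSum → Set
L ≈√ R = (L ≤√ R) × (R ≤√ L)

SO : ∀ {n} → Graph n → RadSum
SO {n} G = concatMap (λ u → concatMap (λ v →
    if adj G u v ∧ (toℕ u <ᵇ toℕ v)
    then [ (1 , fromℕ (deg G u ^ 2 + deg G v ^ 2)) ]
    else []) (allFin n)) (allFin n)

bound : ℕ → ℕ → RadSum
bound n k =
  ((n ∸ k ∸ 2) * (n ∸ k ∸ 1) ^ 2 , (+ 1) / 2) ∷
  (k , fromℕ ((n ∸ 1) ^ 2 + 1)) ∷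
  (n ∸ k ∸ 1 , fromℕ ((n ∸ 1) ^ 2 + (n ∸ k ∸ 1) ^ 2)) ∷ []

-- K_{n-k} (vertices 0..n-k-1) with k pendent edges attached at vertex 0
-- (vertices n-k..n-1 are the pendent vertices)

private
  ≡ᵇ-sym : ∀ a b → (a ≡ᵇ b) ≡ (b ≡ᵇ a)
  ≡ᵇ-sym zero zero = refl
  ≡ᵇ-sym zero (suc b) = refl
  ≡ᵇ-sym (suc a) zero = refl
  ≡ᵇ-sym (suc a) (suc b) = ≡ᵇ-sym a b

  ≡ᵇ-refl : ∀ a → (a ≡ᵇ a) ≡ true
  ≡ᵇ-refl zero = refl
  ≡ᵇ-refl (suc a) = ≡ᵇ-refl a

module _ (n k : ℕ) where
  private
    m = n ∸ k
    clique : Fin n → Fin n → Bool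
    clique u v = (toℕ u <ᵇ m) ∧ (toℕ v <ᵇ m)
    hub : Fin n → Fin n → Bool
    hub u v = (toℕ u ≡ᵇ 0) ∧ not (toℕ v <ᵇ m)
    kpAdj : Fin n → Fin n → Bool
    kpAdj u v = not (toℕ u ≡ᵇ toℕ v) ∧ (clique u v ∨ (hub u v ∨ hub v u))
    kpSym : ∀ u v → kpAdj u v ≡ kpAdj v u
    kpSym u v = cong₂ _∧_ (cong not (≡ᵇ-sym (toℕ u) (toℕ v)))
                          (cong₂ _∨_ (∧-comm (toℕ u <ᵇ m) (toℕ v <ᵇ m)) (∨-comm (hub u v) (hub v u)))
    kpIrr : ∀ v → kpAdj v v ≡ false
    kpIrr v rewrite ≡ᵇ-refl (toℕ v) = refl

  KPendent : Graph n
  KPendent = record { adj = kpAdj ; sym = kpSym ; irrefl = kpIrr }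

{-# OPTIONS --safe #-}

-- Let M + 1 be the number of non-pendent ("core") vertices and N = M + k = n - 1.
-- A core vertex u has degree at most M + k w(u), where the weights w ≥ 0 on the core
-- sum to 1: w(u) is its share of the pendent vertices, and for k = 0 all the weight sits on one
-- arbitrary core vertex.  The vector (M + k w(u) , M + k w(v)) bounding the degrees of the ends
-- of a core edge is therefore the convex combination of (M , M), (N , M) and (M , N) with weights
-- 1 - w(u) - w(v), w(u) and w(v), so that the length of an edge uv of the core is at most
-- (1 - w(u) - w(v)) √(2M²) + (w(u) + w(v)) √(N² + M²).  Summed over all pairs of core
-- vertices this gives, whatever w is, exactly the first and third terms of the bound, while every
-- pendent edge is at most √(N² + 1).
--
-- For equality, each missing core edge and each pendent edge whose other end has degree < N
-- loses an amount bounded away from 0.  If nothing is lost, all core vertices are adjacent and the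
-- pendent vertices share a neighbour of degree n - 1, which is the extremal graph.

module Submission where

open import Defs
open import Algebra.Bundles using (module CommutativeRing)
open import Data.Bool using (Bool; true; false; _∧_; _∨_; not; if_then_else_; T)
import Data.Bool as Bool
open import Data.Bool.Properties using (¬-not)
open import Data.Empty using (⊥-elim)
open import Data.Fin using (Fin; zero; suc; toℕ; punchIn; punchOut)
import Data.Fin as Fin
open import Data.Fin.Permutation using (Permutation; _⟨$⟩ʳ_; _⟨$⟩ˡ_)
import Data.Fin.Permutation as Perm
import Data.Fin.Permutation.Components as PC
open import Data.Fin.Properties using (_≟_; any?; punchInᵢ≢i; punchIn-punchOut; toℕ-fromℕ; toℕ-injective)
import Data.Integer as ℤ
import Data.Integer.Properties as ℤ
open import Data.List using ([]; _∷_; _++_; map; concatMap; allFin; tabulate)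
open import Data.List.Properties using (map-tabulate)
open import Data.List.Relation.Unary.All using (All; []; _∷_)
import Data.List.Relation.Unary.All.Properties as All
open import Data.Nat using (ℕ; zero; suc; _≥_; _≡ᵇ_; _<ᵇ_)
import Data.Nat as ℕ
open import Data.Nat.ListAction using () renaming (sum to sumᴸ)
import Data.Nat.Properties as ℕ
open import Data.Product using (_×_; _,_; ∃; ∃₂; proj₁; proj₂)
open import Data.Rational using (ℚ; 0ℚ; 1ℚ; ½; _+_; _*_; _-_; -_; _≤_; _<_; 1/_; mkℚ; *≤*; nonNegative; positive; toℚᵘ)
open import Data.Rational.Properties as ℚ using (module ≤-Reasoning)
open import Algebra.Properties.Semiring.Sum (CommutativeRing.semiring ℚ.+-*-commutativeRing)
open import Data.Rational.Solver using (module +-*-Solver)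
import Data.Rational.Unnormalised as ℚᵘ
import Data.Rational.Unnormalised.Properties as ℚᵘ
open import Data.Sum using (_⊎_; inj₁; inj₂)
open import Data.Vec.Functional using (Vector; removeAt)
open import Function using (_∘_; id)
open import Function.Bundles using (_⇔_; mk⇔)
open import Relation.Binary.Definitions using (tri<; tri≈; tri>)
open import Relation.Binary.PropositionalEquality as ≡ using (_≡_; _≢_; refl; cong; cong₂; subst)
open import Relation.Nullary using (¬_; Dec; yes; no; contradiction; does)
open import Relation.Nullary.Decidable using (dec-true; dec-false)

-- Rational arithmetic

-- The two values are known only through rational approximations, so no square root is ever formed:
-- every estimate of a length is proved for arbitrary rationals whose squares lie on the correct
-- side of the radicand. This shapes the equality case. An inequality between values can be refuted
-- only by a gap of fixed size that survives every approximation. The inequality is therefore proved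
-- in the stronger form SO + `deficiency` / 4 ≤ bound, where `deficiency` counts the ordered pairs
-- at which something is lost. Being a count, it is 0 or at least 1, and a finite search decides
-- which. Only those two kinds of loss are counted whose absence determines the graph. For the
-- extremal graph the same pair bounds are reused with all the weight on the hub, where convexity
-- estimates become exact lengths. The total of the pair bounds is thus computed once, as an
-- identity, and serves both directions.

0≤p+q : ∀ {p q} → 0ℚ ≤ p → 0ℚ ≤ q → 0ℚ ≤ p + q
0≤p+q = ℚ.+-mono-≤

0≤p*q : ∀ {p q} → 0ℚ ≤ p → 0ℚ ≤ q → 0ℚ ≤ p * q
0≤p*q {p} {q} 0≤p 0≤q =
  subst (_≤ p * q) (ℚ.*-zeroʳ p) (ℚ.*-monoˡ-≤-nonNeg p {{nonNegative 0≤p}} 0≤q)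

p≤q⇒0≤q-p : ∀ {p q} → p ≤ q → 0ℚ ≤ q - p
p≤q⇒0≤q-p {p} {q} p≤q = subst (_≤ q - p) (ℚ.+-inverseʳ p) (ℚ.+-monoˡ-≤ (- p) p≤q)

0≤q-p⇒p≤q : ∀ {p q} → 0ℚ ≤ q - p → p ≤ q
0≤q-p⇒p≤q {p} {q} 0≤q-p = ≡.subst₂ _≤_ (ℚ.+-identityˡ p)
  (solve 2 (λ q p → q :- p :+ p := q) refl q p) (ℚ.+-monoˡ-≤ p 0≤q-p)
  where open +-*-Solver

-- Polynomial inequalities are certified by an identity: the ring solver rewrites `q - p` as an
-- expression `r` that is non-negative by its shape.
≤-by-difference : ∀ {p q r} → 0ℚ ≤ r → q - p ≡ r → p ≤ q
≤-by-difference 0≤r q-p≡r = 0≤q-p⇒p≤q (subst (0ℚ ≤_) (≡.sym q-p≡r) 0≤r)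

square-mono-≤ : ∀ {p q} → 0ℚ ≤ p → p ≤ q → p * p ≤ q * q
square-mono-≤ {p} {q} 0≤p p≤q = ≤-by-difference
  (0≤p*q (p≤q⇒0≤q-p p≤q) (0≤p+q (ℚ.≤-trans 0≤p p≤q) 0≤p))
  (solve 2 (λ p q → q :* q :- p :* p := (q :- p) :* (q :+ p)) refl p q)
  where open +-*-Solver

-- This takes the place of extracting roots. Only the upper side has to be known non-negative, since
-- a negative `p` lies below it anyway.
square-cancel-≤ : ∀ {p q} → 0ℚ ≤ q → p * p ≤ q * q → p ≤ q
square-cancel-≤ {p} {q} 0≤q pp≤qq with p ℚ.≤? q
... | yes p≤q = p≤q
... | no  p≰q = contradiction (ℚ.≤-<-trans pp≤qq qq<pp) (ℚ.<-irrefl refl)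
  where
  q<p = ℚ.≰⇒> p≰q
  qq<pp : q * q < p * p
  qq<pp = ℚ.≤-<-trans
    (ℚ.*-monoˡ-≤-nonNeg q {{nonNegative 0≤q}} (ℚ.<⇒≤ q<p))
    (ℚ.*-monoˡ-<-pos p {{positive (ℚ.≤-<-trans 0≤q q<p)}} q<p)

*-monoˡ-≤ : ∀ {p q} r → 0ℚ ≤ r → p ≤ q → r * p ≤ r * q
*-monoˡ-≤ r 0≤r = ℚ.*-monoˡ-≤-nonNeg r {{nonNegative 0≤r}}

*-monoʳ-≤ : ∀ {p q} r → 0ℚ ≤ r → p ≤ q → p * r ≤ q * r
*-monoʳ-≤ r 0≤r = ℚ.*-monoʳ-≤-nonNeg r {{nonNegative 0≤r}}

0≤square : ∀ p → 0ℚ ≤ p * p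
0≤square p with ℚ.≤-total 0ℚ p
... | inj₁ 0≤p = 0≤p*q 0≤p 0≤p
... | inj₂ p≤0 = subst (0ℚ ≤_)
  (solve 1 (λ p → (con 0ℚ :- p) :* (con 0ℚ :- p) := p :* p) refl p)
  (0≤p*q (p≤q⇒0≤q-p p≤0) (p≤q⇒0≤q-p p≤0))
  where open +-*-Solver

-- `fromℕ` normalises through a gcd that is stuck on a variable `m`, so its arithmetic is checked on
-- unnormalised rationals.
toℚᵘ-fromℕ : ∀ m → toℚᵘ (fromℕ m) ℚᵘ.≃ ℚᵘ.mkℚᵘ (ℤ.+ m) 0
toℚᵘ-fromℕ m = ℚ.toℚᵘ-fromℚᵘ (ℚᵘ.mkℚᵘ (ℤ.+ m) 0)

fromℕ-+ : ∀ m n → fromℕ (m ℕ.+ n) ≡ fromℕ m + fromℕ n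
fromℕ-+ m n = ℚ.toℚᵘ-injective (begin
  toℚᵘ (fromℕ (m ℕ.+ n))                        ≈⟨ toℚᵘ-fromℕ (m ℕ.+ n) ⟩
  ℚᵘ.mkℚᵘ (ℤ.+ (m ℕ.+ n)) 0                     ≈⟨ ℚᵘ.*≡* (cong (ℤ._* ℤ.1ℤ)
    (≡.sym (cong₂ ℤ._+_ (ℤ.*-identityʳ (ℤ.+ m)) (ℤ.*-identityʳ (ℤ.+ n))))) ⟩
  ℚᵘ.mkℚᵘ (ℤ.+ m) 0 ℚᵘ.+ ℚᵘ.mkℚᵘ (ℤ.+ n) 0      ≈⟨ ℚᵘ.+-cong (toℚᵘ-fromℕ m) (toℚᵘ-fromℕ n) ⟨
  toℚᵘ (fromℕ m) ℚᵘ.+ toℚᵘ (fromℕ n)            ≈⟨ ℚ.toℚᵘ-homo-+ (fromℕ m) (fromℕ n) ⟨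
  toℚᵘ (fromℕ m + fromℕ n)                      ∎)
  where open ℚᵘ.≃-Reasoning

fromℕ-* : ∀ m n → fromℕ (m ℕ.* n) ≡ fromℕ m * fromℕ n
fromℕ-* m n = ℚ.toℚᵘ-injective (begin
  toℚᵘ (fromℕ (m ℕ.* n))                        ≈⟨ toℚᵘ-fromℕ (m ℕ.* n) ⟩
  ℚᵘ.mkℚᵘ (ℤ.+ (m ℕ.* n)) 0                     ≈⟨ ℚᵘ.*≡* (cong (ℤ._* ℤ.1ℤ) (ℤ.pos-* m n)) ⟩
  ℚᵘ.mkℚᵘ (ℤ.+ m) 0 ℚᵘ.* ℚᵘ.mkℚᵘ (ℤ.+ n) 0      ≈⟨ ℚᵘ.*-cong (toℚᵘ-fromℕ m) (toℚᵘ-fromℕ n) ⟨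
  toℚᵘ (fromℕ m) ℚᵘ.* toℚᵘ (fromℕ n)            ≈⟨ ℚ.toℚᵘ-homo-* (fromℕ m) (fromℕ n) ⟨
  toℚᵘ (fromℕ m * fromℕ n)                      ∎)
  where open ℚᵘ.≃-Reasoning

fromℕ-mono-≤ : ∀ {m n} → m ℕ.≤ n → fromℕ m ≤ fromℕ n
fromℕ-mono-≤ {m} {n} m≤n = ℚ.toℚᵘ-cancel-≤ (begin
  toℚᵘ (fromℕ m)      ≃⟨ toℚᵘ-fromℕ m ⟩
  ℚᵘ.mkℚᵘ (ℤ.+ m) 0   ≤⟨ ℚᵘ.*≤* (ℤ.*-monoʳ-≤-nonNeg ℤ.1ℤ (ℤ.+≤+ m≤n)) ⟩
  ℚᵘ.mkℚᵘ (ℤ.+ n) 0   ≃⟨ toℚᵘ-fromℕ n ⟨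
  toℚᵘ (fromℕ n)      ∎)
  where open ℚᵘ.≤-Reasoning

fromℕ-cancel-≤ : ∀ {m n} → fromℕ m ≤ fromℕ n → m ℕ.≤ n
fromℕ-cancel-≤ {m} {n} m≤n with m ℕ.≤? n
... | yes p = p
... | no ¬p = contradiction
  (ℚ.≤-trans (subst (_≤ fromℕ m) (fromℕ-+ 1 n) (fromℕ-mono-≤ (ℕ.≰⇒> ¬p))) m≤n)
  (λ 1+n≤n → contradiction (≤-absurd 1+n≤n) λ { (*≤* (ℤ.+≤+ ())) })
  where
  open +-*-Solver
  ≤-absurd : 1ℚ + fromℕ n ≤ fromℕ n → 1ℚ ≤ 0ℚ
  ≤-absurd le = ≤-by-difference (p≤q⇒0≤q-p le)
    (solve 1 (λ x → con 0ℚ :- con 1ℚ := x :- (con 1ℚ :+ x)) refl (fromℕ n))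

fromℕ-injective : ∀ {m n} → fromℕ m ≡ fromℕ n → m ≡ n
fromℕ-injective eq = ℕ.≤-antisym (fromℕ-cancel-≤ (ℚ.≤-reflexive eq)) (fromℕ-cancel-≤ (ℚ.≤-reflexive (≡.sym eq)))

0≤fromℕ : ∀ m → 0ℚ ≤ fromℕ m
0≤fromℕ m = fromℕ-mono-≤ {0} {m} ℕ.z≤n

fromℕ-² : ∀ m → fromℕ (m ℕ.^ 2) ≡ fromℕ m * fromℕ m
fromℕ-² m = ≡.trans (cong (λ x → fromℕ (m ℕ.* x)) (ℕ.*-identityʳ m)) (fromℕ-* m m)

module _ {M K a b q₁ q₃} (0≤M : 0ℚ ≤ M) (0≤K : 0ℚ ≤ K) (0≤a : 0ℚ ≤ a) (0≤b : 0ℚ ≤ b)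
  (a+b≤1 : a + b ≤ 1ℚ) (0≤q₁ : 0ℚ ≤ q₁) (0≤q₃ : 0ℚ ≤ q₃) (h₁ : M * M + M * M ≤ q₁ * q₁)
  (h₃ : (M + K) * (M + K) + M * M ≤ q₃ * q₃) where
  private
    N = M + K
    c = 1ℚ - (a + b)
    s = a + b
  open +-*-Solver
  open ≤-Reasoning

  -- Cauchy-Schwarz for (M , M) and (N , M), whose lengths are at most `q₁` and `q₃`. It controls
  -- the mixed term when the combination in `norm-convex` is squared.
  cauchy : M * (N + M) ≤ q₁ * q₃
  cauchy = square-cancel-≤ (0≤p*q 0≤q₁ 0≤q₃) (begin
    M * (N + M) * (M * (N + M))          ≤⟨ ≤-by-difference (0≤square (M * (N - M)))
                                             (solve 2 (λ M N →
                                               (M :* M :+ M :* M) :* (N :* N :+ M :* M)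
                                                 :- M :* (N :+ M) :* (M :* (N :+ M))
                                               := M :* (N :- M) :* (M :* (N :- M))) refl M N) ⟩
    (M * M + M * M) * (N * N + M * M)    ≤⟨ *-monoʳ-≤ (N * N + M * M) (0≤p+q (0≤square N) (0≤square M)) h₁ ⟩
    q₁ * q₁ * (N * N + M * M)            ≤⟨ *-monoˡ-≤ (q₁ * q₁) (0≤square q₁) h₃ ⟩
    q₁ * q₁ * (q₃ * q₃)                  ≡⟨ solve 2 (λ x y → x :* x :* (y :* y) := x :* y :* (x :* y)) refl q₁ q₃ ⟩
    q₁ * q₃ * (q₁ * q₃)                  ∎)

  -- (M + K a , M + K b) is the convex combination of (M , M), (N , M) and
  -- (M , N) with weights 1 - a - b, a and b, so this is convexity of the norm.
  norm-convex : ∀ {x y p} → 0ℚ ≤ x → 0ℚ ≤ y → x ≤ M + K * a → y ≤ M + K * b →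
                p * p ≤ x * x + y * y → p ≤ c * q₁ + s * q₃
  norm-convex {x} {y} {p} 0≤x 0≤y x≤ y≤ pp≤ = square-cancel-≤
    (0≤p+q (0≤p*q 0≤c 0≤q₁) (0≤p*q 0≤s 0≤q₃)) (begin
    p * p                                                    ≤⟨ pp≤ ⟩
    x * x + y * y                                            ≤⟨ ℚ.+-mono-≤ (square-mono-≤ 0≤x x≤) (square-mono-≤ 0≤y y≤) ⟩
    (M + K * a) * (M + K * a) + (M + K * b) * (M + K * b)    ≤⟨ ≤-by-difference
      (0≤p+q (0≤p+q (0≤p+q
        (0≤p*q (0≤square c) (p≤q⇒0≤q-p h₁))
        (0≤p*q (0≤p+q (0≤p*q 0≤c 0≤s) (0≤p*q 0≤c 0≤s)) (p≤q⇒0≤q-p cauchy)))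
        (0≤p*q (0≤square s) (p≤q⇒0≤q-p h₃)))
        -- The mixed term of (N , M) and (M , N): N² + M² exceeds their inner product 2NM by (N -
        -- M)² = K².
        (0≤p*q (0≤p+q (0≤p*q 0≤a 0≤b) (0≤p*q 0≤a 0≤b)) (0≤square K)))
      (solve 6 (λ M K a b q₁ q₃ → let N = M :+ K; s = a :+ b; c = con 1ℚ :- s; R = c :* q₁ :+ s :* q₃ in
        R :* R :- ((M :+ K :* a) :* (M :+ K :* a) :+ (M :+ K :* b) :* (M :+ K :* b))
        := c :* c :* (q₁ :* q₁ :- (M :* M :+ M :* M))
          :+ (c :* s :+ c :* s) :* (q₁ :* q₃ :- M :* (N :+ M))
          :+ s :* s :* (q₃ :* q₃ :- (N :* N :+ M :* M))
          :+ (a :* b :+ a :* b) :* (K :* K)) refl M K a b q₁ q₃) ⟩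
    (c * q₁ + s * q₃) * (c * q₁ + s * q₃)                    ∎)
    where
    0≤s = 0≤p+q 0≤a 0≤b
    0≤c = p≤q⇒0≤q-p a+b≤1

-- Finite sums

𝟙 : Bool → ℚ
𝟙 b = if b then 1ℚ else 0ℚ

0≤𝟙 : ∀ b → 0ℚ ≤ 𝟙 b
0≤𝟙 true  = fromℕ-mono-≤ {0} {1} ℕ.z≤n
0≤𝟙 false = ℚ.≤-refl

sum-mono-≤ : ∀ {n} {f g : Vector ℚ n} → (∀ i → f i ≤ g i) → sum f ≤ sum g
sum-mono-≤ {zero}  f≤g = ℚ.≤-refl
sum-mono-≤ {suc n} f≤g = ℚ.+-mono-≤ (f≤g zero) (sum-mono-≤ (f≤g ∘ suc))

0≤sum : ∀ {n} {f : Vector ℚ n} → (∀ i → 0ℚ ≤ f i) → 0ℚ ≤ sum f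
0≤sum {zero}  0≤f = ℚ.≤-refl
0≤sum {suc n} 0≤f = 0≤p+q (0≤f zero) (0≤sum (0≤f ∘ suc))

term≤sum : ∀ {n} {f : Vector ℚ n} → (∀ i → 0ℚ ≤ f i) → ∀ i → f i ≤ sum f
term≤sum {suc n} {f} 0≤f i = ≤-by-difference (0≤sum (0≤f ∘ punchIn i)) (begin
  sum f - f i                        ≡⟨ cong (_- f i) (sum-remove f) ⟩
  f i + sum (removeAt f i) - f i     ≡⟨ solve 2 (λ x y → x :+ y :- x := y) refl (f i) (sum (removeAt f i)) ⟩
  sum (removeAt f i)                 ∎)
  where open ≡.≡-Reasoning; open +-*-Solver

two-terms≤sum : ∀ {n} {f : Vector ℚ n} → (∀ i → 0ℚ ≤ f i) → ∀ {i j} → i ≢ j → f i + f j ≤ sum f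
two-terms≤sum {suc n} {f} 0≤f {i} {j} i≢j = begin
  f i + f j                                ≡⟨ cong (λ k → f i + f k) (punchIn-punchOut i≢j) ⟨
  f i + f (punchIn i (punchOut i≢j))       ≤⟨ ℚ.+-monoʳ-≤ (f i) (term≤sum (0≤f ∘ punchIn i) (punchOut i≢j)) ⟩
  f i + sum (removeAt f i)                 ≡⟨ sum-remove f ⟨
  sum f                                    ∎
  where open ≤-Reasoning

-- A single gap `g i - f i` is at most the sum of all gaps, which is at most 0.
sum-tight : ∀ {n} {f g : Vector ℚ n} → (∀ i → f i ≤ g i) → sum g ≤ sum f → ∀ i → g i ≤ f i
sum-tight {n} {f} {g} f≤g Σg≤Σf i = 0≤q-p⇒p≤q (subst (0ℚ ≤_)
  (solve 2 (λ x y → con 0ℚ :- (y :- x) := x :- y) refl (f i) (g i)) (p≤q⇒0≤q-p (begin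
    g i - f i                        ≤⟨ term≤sum (λ j → p≤q⇒0≤q-p (f≤g j)) i ⟩
    ∑[ j < n ] (g j - f j)           ≤⟨ ≤-by-difference (p≤q⇒0≤q-p Σg≤Σf) difference ⟩
    0ℚ                               ∎)))
  where
  open ≤-Reasoning
  open +-*-Solver
  difference : 0ℚ - (∑[ j < n ] (g j - f j)) ≡ sum f - sum g
  difference = ≡.trans
    (solve 3 (λ d x y → con 0ℚ :- d := x :- (d :+ x)) refl (∑[ j < n ] (g j - f j)) (sum f) (sum g))
    (cong (λ z → sum f - z) (≡.trans (≡.sym (∑-distrib-+ (λ j → g j - f j) f))
      (sum-cong-≗ λ j → solve 2 (λ x y → y :- x :+ x := y) refl (f j) (g j))))

fromℕ-sum : ∀ {n} (f : Fin n → ℕ) → fromℕ (sumᴸ (map f (allFin n))) ≡ sum (fromℕ ∘ f)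
fromℕ-sum f = ≡.trans (cong (fromℕ ∘ sumᴸ) (map-tabulate id f)) (go f)
  where
  go : ∀ {n} (f : Fin n → ℕ) → fromℕ (sumᴸ (tabulate f)) ≡ sum (fromℕ ∘ f)
  go {zero}  f = refl
  go {suc n} f = ≡.trans (fromℕ-+ (f zero) _) (cong (fromℕ (f zero) +_) (go (f ∘ suc)))

fromℕ-count : ∀ {n} (b : Fin n → Bool) →
              fromℕ (sumᴸ (map (λ i → if b i then 1 else 0) (allFin n))) ≡ sum (𝟙 ∘ b)
fromℕ-count b = ≡.trans (fromℕ-sum (λ i → if b i then 1 else 0)) (sum-cong-≗ λ i → go (b i))
  where
  go : ∀ b → fromℕ (if b then 1 else 0) ≡ 𝟙 b
  go true  = refl
  go false = refl

_≠ᵇ_ : ∀ {n} → Fin n → Fin n → Bool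
i ≠ᵇ j = not (does (i ≟ j))

≢⇒≠ᵇ : ∀ {n} {i j : Fin n} → i ≢ j → i ≠ᵇ j ≡ true
≢⇒≠ᵇ {i = i} {j} i≢j = cong not (dec-false (i ≟ j) i≢j)

≠ᵇ-irrefl : ∀ {n} (i : Fin n) → i ≠ᵇ i ≡ false
≠ᵇ-irrefl i = cong not (dec-true (i ≟ i) refl)

≠ᵇ-sym : ∀ {n} (i j : Fin n) → i ≠ᵇ j ≡ j ≠ᵇ i
≠ᵇ-sym i j with i ≟ j
... | yes refl = ≡.sym (≠ᵇ-irrefl i)
... | no i≢j   = ≡.sym (≢⇒≠ᵇ (i≢j ∘ ≡.sym))

-- Masking the index `i` instead of removing it keeps the index set `Fin n`, so that double sums can
-- still be exchanged.
sum-split : ∀ {n} (f : Vector ℚ n) i → sum f ≡ f i + (∑[ j < n ] (𝟙 (i ≠ᵇ j) * f j))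
sum-split {suc n} f i = ≡.trans (sum-remove {i = i} f) (cong (f i +_) (≡.sym (begin
  sum g                            ≡⟨ sum-remove {i = i} g ⟩
  g i + sum (removeAt g i)         ≡⟨ cong₂ _+_ gi≡0 (sum-cong-≗ others) ⟩
  0ℚ + sum (removeAt f i)          ≡⟨ ℚ.+-identityˡ _ ⟩
  sum (removeAt f i)               ∎)))
  where
  open ≡.≡-Reasoning
  g : Vector ℚ (suc n)
  g j = 𝟙 (i ≠ᵇ j) * f j
  gi≡0 : g i ≡ 0ℚ
  gi≡0 = ≡.trans (cong (λ b → 𝟙 b * f i) (≠ᵇ-irrefl i)) (ℚ.*-zeroˡ (f i))
  others : ∀ j → g (punchIn i j) ≡ f (punchIn i j)
  others j = ≡.trans (cong (λ b → 𝟙 b * f (punchIn i j)) (≢⇒≠ᵇ (punchInᵢ≢i i j ∘ ≡.sym)))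
                     (ℚ.*-identityˡ _)

_<ᶠ_ : ∀ {n} → Fin n → Fin n → Bool
i <ᶠ j = toℕ i <ᵇ toℕ j

<ᵇ-true : ∀ {m n} → m ℕ.< n → (m <ᵇ n) ≡ true
<ᵇ-true {m} {n} = dec-true (m ℕ.<? n)

<ᵇ-false : ∀ {m n} → ¬ m ℕ.< n → (m <ᵇ n) ≡ false
<ᵇ-false {m} {n} = dec-false (m ℕ.<? n)

upperSum : ∀ {n} → (Fin n → Fin n → ℚ) → ℚ
upperSum {n} T = ∑[ i < n ] ∑[ j < n ] (𝟙 (i <ᶠ j) * T i j)

-- Exchanging the summations turns one copy of the upper triangle into the lower one. From here on
-- pairs are summed without regard to order, and the bound appears doubled.
upperSum-symmetric : ∀ {n} (T : Fin n → Fin n → ℚ) → (∀ i j → T i j ≡ T j i) → (∀ i → T i i ≡ 0ℚ) →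
                     upperSum T + upperSum T ≡ ∑[ i < n ] ∑[ j < n ] T i j
upperSum-symmetric {n} T T-sym T-diag = begin
  upperSum T + upperSum T
    ≡⟨ cong (upperSum T +_) (∑-comm {n} {n} (λ i j → 𝟙 (i <ᶠ j) * T i j)) ⟩
  (∑[ i < n ] ∑[ j < n ] (𝟙 (i <ᶠ j) * T i j)) + (∑[ i < n ] ∑[ j < n ] (𝟙 (j <ᶠ i) * T j i))
    ≡⟨ ∑-distrib-+ {n} _ _ ⟨
  (∑[ i < n ] ((∑[ j < n ] (𝟙 (i <ᶠ j) * T i j)) + (∑[ j < n ] (𝟙 (j <ᶠ i) * T j i))))
    ≡⟨ sum-cong-≗ {n} (λ i → ≡.trans (≡.sym (∑-distrib-+ {n} _ _)) (sum-cong-≗ {n} (pair i))) ⟩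
  (∑[ i < n ] ∑[ j < n ] T i j) ∎
  where
  open ≡.≡-Reasoning
  open +-*-Solver
  pair : ∀ i j → 𝟙 (i <ᶠ j) * T i j + 𝟙 (j <ᶠ i) * T j i ≡ T i j
  pair i j with ℕ.<-cmp (toℕ i) (toℕ j)
  ... | tri< i<j _ ¬j<i rewrite <ᵇ-true i<j | <ᵇ-false ¬j<i =
        solve 2 (λ x y → con 1ℚ :* x :+ con 0ℚ :* y := x) refl (T i j) (T j i)
  ... | tri> ¬i<j _ j<i rewrite <ᵇ-false ¬i<j | <ᵇ-true j<i =
        ≡.trans (solve 2 (λ x y → con 0ℚ :* x :+ con 1ℚ :* y := y) refl (T i j) (T j i)) (T-sym j i)
  ... | tri≈ ¬i<j i≡j ¬j<i rewrite <ᵇ-false ¬i<j | <ᵇ-false ¬j<i | toℕ-injective i≡j =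
        ≡.trans (solve 2 (λ x y → con 0ℚ :* x :+ con 0ℚ :* y := con 0ℚ) refl (T j j) (T j j))
                (≡.sym (T-diag j))

-- Approximations of the Sombor index

Lower-++ : ∀ xs {ys z} → Lower (xs ++ ys) z → ∃₂ λ x y → Lower xs x × Lower ys y × z ≡ x + y
Lower-++ []             l = _ , _ , lnil , l , ≡.sym (ℚ.+-identityˡ _)
Lower-++ ((c , a) ∷ xs) (lcons p 0≤p pp≤a l) with Lower-++ xs l
... | _ , _ , lx , ly , refl = _ , _ , lcons p 0≤p pp≤a lx , ly , ≡.sym (ℚ.+-assoc (fromℕ c * p) _ _)

Upper-++ : ∀ xs {ys z} → Upper (xs ++ ys) z → ∃₂ λ x y → Upper xs x × Upper ys y × z ≡ x + y
Upper-++ []             l = _ , _ , unil , l , ≡.sym (ℚ.+-identityˡ _)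
Upper-++ ((c , a) ∷ xs) (ucons q 0≤q a≤qq l) with Upper-++ xs l
... | _ , _ , lx , ly , refl = _ , _ , ucons q 0≤q a≤qq lx , ly , ≡.sym (ℚ.+-assoc (fromℕ c * q) _ _)

Lower-concatMap : ∀ {n} (f : Fin n → RadSum) {b : Vector ℚ n} →
                  (∀ i {x} → Lower (f i) x → x ≤ b i) →
                  ∀ {x} → Lower (concatMap f (allFin n)) x → x ≤ sum b
Lower-concatMap f = go id
  where
  go : ∀ {m} (g : Fin m → _) {b : Vector ℚ m} → (∀ i {x} → Lower (f (g i)) x → x ≤ b i) →
       ∀ {x} → Lower (concatMap f (tabulate g)) x → x ≤ sum b
  go {zero}  g f≤b lnil = ℚ.≤-refl
  go {suc m} g f≤b l with Lower-++ (f (g zero)) l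
  ... | _ , _ , l₀ , l₁ , refl = ℚ.+-mono-≤ (f≤b zero l₀) (go (g ∘ suc) (f≤b ∘ suc) l₁)

Upper-concatMap : ∀ {n} (f : Fin n → RadSum) {b : Vector ℚ n} →
                  (∀ i {y} → Upper (f i) y → b i ≤ y) →
                  ∀ {y} → Upper (concatMap f (allFin n)) y → sum b ≤ y
Upper-concatMap f = go id
  where
  go : ∀ {m} (g : Fin m → _) {b : Vector ℚ m} → (∀ i {y} → Upper (f (g i)) y → b i ≤ y) →
       ∀ {y} → Upper (concatMap f (tabulate g)) y → sum b ≤ y
  go {zero}  g b≤f unil = ℚ.≤-refl
  go {suc m} g b≤f l with Upper-++ (f (g zero)) l
  ... | _ , _ , l₀ , l₁ , refl = ℚ.+-mono-≤ (b≤f zero l₀) (go (g ∘ suc) (b≤f ∘ suc) l₁)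

-- The summand of `SO` with its two tests as plain Booleans, so that case distinctions on them make
-- the `if` compute.
optionalTerm : Bool → Bool → ℚ → RadSum
optionalTerm a b e = if a ∧ b then (1 , e) ∷ [] else []

Lower-optionalTerm : ∀ a b {e t x} → (a ≡ true → ∀ p → p * p ≤ e → p ≤ t) → (a ≡ false → 0ℚ ≤ t) →
                     Lower (optionalTerm a b e) x → x ≤ 𝟙 b * t
Lower-optionalTerm true true {t = t} edge _ (lcons p _ pp≤e lnil) = begin
  fromℕ 1 * p + 0ℚ    ≡⟨ solve 1 (λ p → con 1ℚ :* p :+ con 0ℚ := p) refl p ⟩
  p                   ≤⟨ edge refl p pp≤e ⟩
  t                   ≡⟨ ℚ.*-identityˡ t ⟨
  1ℚ * t              ∎
  where open ≤-Reasoning; open +-*-Solver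
Lower-optionalTerm true  false {t = t} _ _       lnil = ℚ.≤-reflexive (≡.sym (ℚ.*-zeroˡ t))
Lower-optionalTerm false true          _ nonedge lnil = 0≤p*q (0≤𝟙 true) (nonedge refl)
Lower-optionalTerm false false {t = t} _ _       lnil = ℚ.≤-reflexive (≡.sym (ℚ.*-zeroˡ t))

Upper-optionalTerm : ∀ a b {e t y} → (a ≡ true → ∀ q → 0ℚ ≤ q → e ≤ q * q → t ≤ q) → (a ≡ false → t ≤ 0ℚ) →
                     Upper (optionalTerm a b e) y → 𝟙 b * t ≤ y
Upper-optionalTerm true true {t = t} edge _ (ucons q 0≤q e≤qq unil) = begin
  1ℚ * t              ≡⟨ ℚ.*-identityˡ t ⟩
  t                   ≤⟨ edge refl q 0≤q e≤qq ⟩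
  q                   ≡⟨ solve 1 (λ q → con 1ℚ :* q :+ con 0ℚ := q) refl q ⟨
  fromℕ 1 * q + 0ℚ    ∎
  where open ≤-Reasoning; open +-*-Solver
Upper-optionalTerm true  false {t = t} _ _       unil = ℚ.≤-reflexive (ℚ.*-zeroˡ t)
Upper-optionalTerm false true  {t = t} _ nonedge unil =
  ℚ.≤-trans (ℚ.≤-reflexive (ℚ.*-identityˡ t)) (nonedge refl)
Upper-optionalTerm false false {t = t} _ _       unil = ℚ.≤-reflexive (ℚ.*-zeroˡ t)

edgeWeight² : ∀ {n} → Graph n → Fin n → Fin n → ℚ
edgeWeight² G u v = fromℕ (deg G u ℕ.^ 2 ℕ.+ deg G v ℕ.^ 2)

module _ {n} (G : Graph n) (T : Fin n → Fin n → ℚ) where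

  -- Non-edges may carry a positive `T u v`. This is what allows all core pairs to be counted,
  -- adjacent or not.
  Lower-SO : (∀ u v → adj G u v ≡ true → ∀ p → p * p ≤ edgeWeight² G u v → p ≤ T u v) →
             (∀ u v → adj G u v ≡ false → 0ℚ ≤ T u v) →
             ∀ {x} → Lower (SO G) x → x ≤ upperSum T
  Lower-SO edge nonedge = Lower-concatMap _ λ u → Lower-concatMap _ λ v →
    Lower-optionalTerm (adj G u v) (u <ᶠ v) (edge u v) (nonedge u v)

  Upper-SO : (∀ u v → adj G u v ≡ true → ∀ q → 0ℚ ≤ q → edgeWeight² G u v ≤ q * q → T u v ≤ q) →
             (∀ u v → adj G u v ≡ false → T u v ≤ 0ℚ) →
             ∀ {y} → Upper (SO G) y → upperSum T ≤ y
  Upper-SO edge nonedge = Upper-concatMap _ λ u → Upper-concatMap _ λ v →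
    Upper-optionalTerm (adj G u v) (u <ᶠ v) (edge u v) (nonedge u v)

-- Rational approximations of square roots

0≤½ : 0ℚ ≤ ½
0≤½ = ℚ.nonNegative⁻¹ ½

½^_ : ℕ → ℚ
½^ zero  = 1ℚ
½^ suc j = ½ * ½^ j

0≤½^ : ∀ j → 0ℚ ≤ ½^ j
0≤½^ zero    = 0≤fromℕ 1
0≤½^ (suc j) = 0≤p*q 0≤½ (0≤½^ j)

-- Bernoulli's inequality 1 + j ≤ 2^j, divided by 2^j.
[1+j]½^j≤1 : ∀ j → (1ℚ + fromℕ j) * ½^ j ≤ 1ℚ
[1+j]½^j≤1 zero    = ℚ.≤-refl
[1+j]½^j≤1 (suc j) = ≤-by-difference
  (0≤p+q (p≤q⇒0≤q-p ([1+j]½^j≤1 j)) (0≤p*q 0≤½ (0≤p*q (0≤fromℕ j) (0≤½^ j))))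
  (≡.trans (cong (λ x → 1ℚ - (1ℚ + x) * (½ * ½^ j)) (fromℕ-+ 1 j))
    (solve 2 (λ x h → con 1ℚ :- (con 1ℚ :+ (con 1ℚ :+ x)) :* (con ½ :* h)
      := (con 1ℚ :- (con 1ℚ :+ x) :* h) :+ con ½ :* (x :* h)) refl (fromℕ j) (½^ j)))
  where open +-*-Solver

≤fromℕ : ∀ p → ∃ λ m → p ≤ fromℕ m
≤fromℕ p@(mkℚ i d _) = ℤ.∣ i ∣ , ℚ.toℚᵘ-cancel-≤ (ℚᵘ.≤-respʳ-≃ (ℚᵘ.≃-sym (toℚᵘ-fromℕ ℤ.∣ i ∣))
  (ℚᵘ.*≤* (subst (ℤ._≤ ℤ.+ ℤ.∣ i ∣ ℤ.* ℤ.+ suc d) (≡.sym (ℤ.*-identityʳ i))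
    (ℤ.≤-trans (i≤∣i∣ i) (subst (ℤ.+ ℤ.∣ i ∣ ℤ.≤_) (ℤ.pos-* ℤ.∣ i ∣ (suc d))
      (ℤ.+≤+ (ℕ.m≤m*n ℤ.∣ i ∣ (suc d))))))))
  where
  i≤∣i∣ : ∀ i → i ℤ.≤ ℤ.+ ℤ.∣ i ∣
  i≤∣i∣ (ℤ.+ _)    = ℤ.≤-refl
  i≤∣i∣ ℤ.-[1+ _ ] = ℤ.-≤+

-- For an integer m ≥ b, the inequality 1 ≤ b / 2^m together with (1 + m) / 2^m ≤ 1 would force 1 /
-- 2^m ≤ 0.
archimedean : ∀ b → ∃ λ j → b * ½^ j < 1ℚ
archimedean b with ≤fromℕ b
... | m , b≤m = m , ℚ.≰⇒> λ 1≤ → contradiction (½^≤0 1≤) (½^≰0 m)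
  where
  open +-*-Solver
  ½^≤0 : 1ℚ ≤ b * ½^ m → ½^ m ≤ 0ℚ
  ½^≤0 1≤ = ≤-by-difference
    (0≤p+q (0≤p+q (p≤q⇒0≤q-p 1≤) (0≤p*q (p≤q⇒0≤q-p b≤m) (0≤½^ m))) (p≤q⇒0≤q-p ([1+j]½^j≤1 m)))
    (solve 3 (λ b x h → con 0ℚ :- h := (b :* h :- con 1ℚ) :+ (x :- b) :* h :+ (con 1ℚ :- (con 1ℚ :+ x) :* h))
      refl b (fromℕ m) (½^ m))
  ½^≰0 : ∀ j → ¬ ½^ j ≤ 0ℚ
  ½^≰0 zero    (*≤* (ℤ.+≤+ ()))
  ½^≰0 (suc j) le = ½^≰0 j (≤-by-difference (0≤p+q (p≤q⇒0≤q-p le) (p≤q⇒0≤q-p le))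
    (solve 1 (λ h → con 0ℚ :- h := (con 0ℚ :- con ½ :* h) :+ (con 0ℚ :- con ½ :* h)) refl (½^ j)))

-- An interval around √a. Its width is prescribed exactly rather than bounded, so that widths of
-- sums are obtained by ring identities.
record Bracket (a w : ℚ) : Set where
  constructor bracket
  field
    {lo hi} : ℚ
    0≤lo    : 0ℚ ≤ lo
    0≤hi    : 0ℚ ≤ hi
    lo²≤a   : lo * lo ≤ a
    a≤hi²   : a ≤ hi * hi
    width   : hi - lo ≡ w

bisect : ∀ {a w} → Bracket a w → Bracket a (½ * w)
bisect {a} {w} (bracket {lo} {hi} 0≤lo 0≤hi lo²≤a a≤hi² width) with ℚ.≤-total (½ * (lo + hi) * (½ * (lo + hi))) a
... | inj₁ mid²≤a = bracket 0≤mid 0≤hi mid²≤a a≤hi²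
  (≡.trans (solve 2 (λ l h → h :- con ½ :* (l :+ h) := con ½ :* (h :- l)) refl lo hi) (cong (½ *_) width))
  where
  open +-*-Solver
  0≤mid = 0≤p*q 0≤½ (0≤p+q 0≤lo 0≤hi)
... | inj₂ a≤mid² = bracket 0≤lo 0≤mid lo²≤a a≤mid²
  (≡.trans (solve 2 (λ l h → con ½ :* (l :+ h) :- l := con ½ :* (h :- l)) refl lo hi) (cong (½ *_) width))
  where
  open +-*-Solver
  0≤mid = 0≤p*q 0≤½ (0≤p+q 0≤lo 0≤hi)

sqrt-bracket : ∀ {a} → 0ℚ ≤ a → ∀ j → Bracket a (½^ j * (1ℚ + a))
-- Bisection starts from [0 , 1 + a], which contains √a because a ≤ (1 + a)².
sqrt-bracket {a} 0≤a zero = bracket ℚ.≤-refl 0≤1+a 0≤a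
  (≤-by-difference (0≤p+q (0≤fromℕ 1) (0≤p+q 0≤a (0≤square a)))
    (solve 1 (λ a → (con 1ℚ :+ a) :* (con 1ℚ :+ a) :- a := con 1ℚ :+ (a :+ a :* a)) refl a))
  (solve 1 (λ a → con 1ℚ :+ a :- con 0ℚ := con 1ℚ :* (con 1ℚ :+ a)) refl a)
  where
  open +-*-Solver
  0≤1+a = 0≤p+q (0≤fromℕ 1) 0≤a
sqrt-bracket {a} 0≤a (suc j) = subst (Bracket a) (≡.sym (ℚ.*-assoc ½ (½^ j) (1ℚ + a))) (bisect (sqrt-bracket 0≤a j))

NonNegTerms : RadSum → Set
NonNegTerms = All (λ t → 0ℚ ≤ proj₂ t)

-- A term (c , a) contributes c (1 + a) / 2^j to the width, so one constant `b` serves every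
-- precision `j`.
approximate : ∀ {L} → NonNegTerms L →
              ∃ λ b → ∀ j → ∃₂ λ x y → Lower L x × Upper L y × y - x ≡ b * ½^ j
approximate [] = 0ℚ , λ j → 0ℚ , 0ℚ , lnil , unil , ≡.sym (ℚ.*-zeroˡ (½^ j))
approximate {(c , a) ∷ L} (0≤a ∷ 0≤L) with approximate 0≤L
... | b , approx = fromℕ c * (1ℚ + a) + b , go
  where
  open +-*-Solver
  go : ∀ j → _
  go j with approx j | sqrt-bracket 0≤a j
  ... | x , y , lx , uy , y-x≡ | bracket {p} {q} 0≤p 0≤q p²≤a a≤q² q-p≡ =
    fromℕ c * p + x , fromℕ c * q + y , lcons p 0≤p p²≤a lx , ucons q 0≤q a≤q² uy , (begin
      fromℕ c * q + y - (fromℕ c * p + x)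
        ≡⟨ solve 5 (λ c p q x y → c :* q :+ y :- (c :* p :+ x) := c :* (q :- p) :+ (y :- x)) refl (fromℕ c) p q x y ⟩
      fromℕ c * (q - p) + (y - x)
        ≡⟨ cong₂ (λ s t → fromℕ c * s + t) q-p≡ y-x≡ ⟩
      fromℕ c * (½^ j * (1ℚ + a)) + b * ½^ j
        ≡⟨ solve 4 (λ c h a b → c :* (h :* a) :+ b :* h := (c :* a :+ b) :* h) refl (fromℕ c) (½^ j) (1ℚ + a) b ⟩
      (fromℕ c * (1ℚ + a) + b) * ½^ j ∎)
    where open ≡.≡-Reasoning

-- If `R ≤√ L` held, a uniform gap `ε` would be at most the sum of the widths of two brackets, one
-- for each side, and these widths tend to 0. The number `c` bounds 1/ε from above and spares a
-- division.
gap⇒¬≥ : ∀ {L R ε c} → NonNegTerms L → NonNegTerms R → 0ℚ ≤ c → 1ℚ ≤ c * ε →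
         (∀ {x y} → Lower L x → Upper R y → x + ε ≤ y) → ¬ R ≤√ L
gap⇒¬≥ {L} {R} {ε} {c} 0≤L 0≤R 0≤c 1≤cε separated R≤L =
  let b  , approxL = approximate 0≤L
      b′ , approxR = approximate 0≤R
      j  , small   = archimedean (c * (b + b′))
      x  , y  , lx  , uy  , y-x≡   = approxL j
      x′ , y′ , lx′ , uy′ , y′-x′≡ = approxR j
  in ℚ.<-irrefl refl (begin-strict
    1ℚ                                ≤⟨ 1≤cε ⟩
    c * ε                             ≤⟨ *-monoˡ-≤ c 0≤c (ε≤ (separated lx uy′) (R≤L x′ y lx′ uy)) ⟩
    c * ((y - x) + (y′ - x′))         ≡⟨ cong₂ (λ s t → c * (s + t)) y-x≡ y′-x′≡ ⟩
    c * (b * ½^ j + b′ * ½^ j)        ≡⟨ factor b b′ (½^ j) ⟩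
    c * (b + b′) * ½^ j               <⟨ small ⟩
    1ℚ                                ∎)
  where
  open +-*-Solver
  open ≤-Reasoning
  factor : ∀ b b′ h → c * (b * h + b′ * h) ≡ c * (b + b′) * h
  factor = solve 4 (λ c b b′ h → c :* (b :* h :+ b′ :* h) := c :* (b :+ b′) :* h) refl c
  ε≤ : ∀ {x y x′ y′} → x + ε ≤ y′ → x′ ≤ y → ε ≤ (y - x) + (y′ - x′)
  ε≤ {x} {y} {x′} {y′} sep le = ≤-by-difference (0≤p+q (p≤q⇒0≤q-p sep) (p≤q⇒0≤q-p le))
    (solve 5 (λ x y x′ y′ ε → ((y :- x) :+ (y′ :- x′)) :- ε := (y′ :- (x :+ ε)) :+ (y :- x′)) refl x y x′ y′ ε)

-- Pendent and core vertices

≡ᵇ-sound : ∀ m n → (m ≡ᵇ n) ≡ true → m ≡ n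
≡ᵇ-sound m n eq = ℕ.≡ᵇ⇒≡ m n (subst T (≡.sym eq) _)

≡ᵇ-complete : ∀ {m n} → m ≡ n → (m ≡ᵇ n) ≡ true
≡ᵇ-complete {zero}  refl = refl
≡ᵇ-complete {suc m} refl = ≡ᵇ-complete {m} refl

𝟙≤1 : ∀ b → 𝟙 b ≤ 1ℚ
𝟙≤1 true  = ℚ.≤-refl
𝟙≤1 false = 0≤𝟙 true

𝟙+𝟙-not : ∀ b → 𝟙 b + 𝟙 (not b) ≡ 1ℚ
𝟙+𝟙-not true  = refl
𝟙+𝟙-not false = refl

sum-linear : ∀ {n} α β (f g : Vector ℚ n) → ∑[ i < n ] (α * f i + β * g i) ≡ α * sum f + β * sum g
sum-linear {n} α β f g = ≡.trans (∑-distrib-+ {n} (λ i → α * f i) (λ i → β * g i))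
  (≡.sym (cong₂ _+_ (*-distribˡ-sum α f) (*-distribˡ-sum β g)))

sum-ones : ∀ n → ∑[ i < n ] 1ℚ ≡ fromℕ n
sum-ones zero    = refl
sum-ones (suc n) = ≡.trans (cong (1ℚ +_) (sum-ones n)) (≡.sym (fromℕ-+ 1 n))

indicator : ∀ {n} → Fin n → Fin n → ℚ
indicator h u = 𝟙 (does (h ≟ u))

sum-indicator : ∀ {n} (h : Fin n) → sum (indicator h) ≡ 1ℚ
sum-indicator {n} h = begin
  sum (indicator h)                                       ≡⟨ sum-split (indicator h) h ⟩
  indicator h h + (∑[ u < n ] (𝟙 (h ≠ᵇ u) * indicator h u)) ≡⟨ cong₂ _+_ at-h (≡.trans (sum-cong-≗ λ u → off-h (does (h ≟ u))) (sum-replicate-zero n)) ⟩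
  1ℚ + 0ℚ                                                 ≡⟨ ℚ.+-identityʳ 1ℚ ⟩
  1ℚ                                                      ∎
  where
  open ≡.≡-Reasoning
  at-h : indicator h h ≡ 1ℚ
  at-h with h ≟ h
  ... | yes _  = refl
  ... | no h≢h = contradiction refl h≢h
  off-h : ∀ b → 𝟙 (not b) * 𝟙 b ≡ 0ℚ
  off-h true  = refl
  off-h false = refl

module _ {n} (G : Graph n) where

  pendent core : Fin n → Bool
  pendent u = deg G u ≡ᵇ 1
  core u = not (pendent u)

  degℚ : ∀ u → fromℕ (deg G u) ≡ ∑[ v < n ] 𝟙 (adj G u v)
  degℚ u = fromℕ-count (adj G u)

  pendent⇒deg≡1 : ∀ {u} → pendent u ≡ true → deg G u ≡ 1
  pendent⇒deg≡1 {u} = ≡ᵇ-sound (deg G u) 1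

  adj⇒≢ : ∀ {u v} → adj G u v ≡ true → u ≢ v
  adj⇒≢ {u} uv refl with ≡.trans (≡.sym uv) (irrefl G u)
  ... | ()

  adj≤≠ᵇ : ∀ u v → 𝟙 (adj G u v) ≤ 𝟙 (u ≠ᵇ v)
  adj≤≠ᵇ u v with adj G u v in uv
  ... | true  = ℚ.≤-reflexive (≡.sym (cong 𝟙 (≢⇒≠ᵇ (adj⇒≢ uv))))
  ... | false = 0≤𝟙 (u ≠ᵇ v)

  pendent-unique : ∀ {u v w} → pendent u ≡ true → adj G u v ≡ true → adj G u w ≡ true → v ≡ w
  pendent-unique {u} {v} {w} pu uv uw with v ≟ w
  ... | yes v≡w = v≡w
  ... | no  v≢w = ⊥-elim (ℕ.1+n≰n (fromℕ-cancel-≤ {2} {1} (begin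
    1ℚ + 1ℚ                                  ≡⟨ cong₂ (λ a b → 𝟙 a + 𝟙 b) uv uw ⟨
    𝟙 (adj G u v) + 𝟙 (adj G u w)            ≤⟨ two-terms≤sum {f = 𝟙 ∘ adj G u} (λ i → 0≤𝟙 (adj G u i)) v≢w ⟩
    (∑[ i < n ] 𝟙 (adj G u i))               ≡⟨ degℚ u ⟨
    fromℕ (deg G u)                          ≡⟨ cong fromℕ (pendent⇒deg≡1 {u} pu) ⟩
    fromℕ 1                                  ∎)))
    where open ≤-Reasoning

  -- Adjacent pendent vertices are each other's only neighbours, so a walk started at one of them
  -- alternates between the two. In a connected graph this leaves no room for a third vertex.
  walk-confined : ∀ {u v} → pendent u ≡ true → pendent v ≡ true → adj G u v ≡ true →
                  ∀ {x y} → Walk G x y → x ≡ u ⊎ x ≡ v → y ≡ u ⊎ y ≡ v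
  walk-confined pu pv uv here         x∈ = x∈
  walk-confined {u} {v} pu pv uv (step xw walk) (inj₁ refl) =
    walk-confined pu pv uv walk (inj₂ (pendent-unique pu xw uv))
  walk-confined {u} {v} pu pv uv (step xw walk) (inj₂ refl) =
    walk-confined pu pv uv walk (inj₁ (pendent-unique pv xw (≡.trans (Graph.sym G v u) uv)))

  walk-start : ∀ {u v} → Walk G u v → u ≢ v → ∃ λ w → adj G u w ≡ true
  walk-start here u≢u         = contradiction refl u≢u
  walk-start (step uw _) _    = _ , uw

two-points-miss : ∀ {n} → n ℕ.≥ 3 → (u v : Fin n) → ¬ (∀ x → x ≡ u ⊎ x ≡ v)
two-points-miss (ℕ.s≤s (ℕ.s≤s (ℕ.s≤s _))) u v cover
  with cover zero | cover (suc zero) | cover (suc (suc zero))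
... | inj₁ refl | inj₁ ()   | _
... | inj₂ refl | inj₂ ()   | _
... | inj₁ refl | inj₂ refl | inj₁ ()
... | inj₁ refl | inj₂ refl | inj₂ ()
... | inj₂ refl | inj₁ refl | inj₁ ()
... | inj₂ refl | inj₁ refl | inj₂ ()

pendents-nonadjacent : ∀ {n} (G : Graph n) → n ℕ.≥ 3 → Connected G → ∀ u v →
                       pendent G u ≡ true → pendent G v ≡ true → adj G u v ≢ true
pendents-nonadjacent G n≥3 conn u v pu pv uv =
  two-points-miss n≥3 u v λ x → walk-confined G pu pv uv (conn u x) (inj₁ refl)

-- Bound for the contribution of a pair u, v: the Booleans say whether u and v are adjacent,
-- u is pendent, v is pendent, and u ≠ v.  Every pair of distinct core vertices counts, adjacent or not.
pairBound : (a p p′ d : Bool) (q B : ℚ) → ℚ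
pairBound a p p′ d q B = 𝟙 a * (𝟙 p + 𝟙 p′) * q + 𝟙 (not p) * 𝟙 (not p′) * 𝟙 d * B

-- The support condition is an equation so that it can absorb the factor `𝟙 (core G u)` inside sums.
record CoreWeights {n} (G : Graph n) : Set where
  field
    w           : Fin n → ℚ
    0≤w         : ∀ u → 0ℚ ≤ w u
    sum-w       : sum w ≡ 1ℚ
    w-supported : ∀ u → 𝟙 (core G u) * w u ≡ w u

module Totals {n} (G : Graph n) (M k : ℕ)
  (sum-pendent : sum (𝟙 ∘ pendent G) ≡ fromℕ k)
  (sum-core : sum (𝟙 ∘ core G) ≡ 1ℚ + fromℕ M) where

  -- The factor `𝟙 (core G u)` makes the count valid for every `u`, so that whole rows can be
  -- rewritten without a case distinction.
  other-core : ∀ u → 𝟙 (core G u) * (∑[ v < n ] (𝟙 (u ≠ᵇ v) * 𝟙 (core G v))) ≡ 𝟙 (core G u) * fromℕ M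
  other-core u = go (core G u) (≡.trans (≡.sym sum-core) (sum-split (𝟙 ∘ core G) u))
    where
    open +-*-Solver
    go : ∀ c {s} → 1ℚ + fromℕ M ≡ 𝟙 c + s → 𝟙 c * s ≡ 𝟙 c * fromℕ M
    go false {s} eq = ≡.trans (ℚ.*-zeroˡ s) (≡.sym (ℚ.*-zeroˡ (fromℕ M)))
    go true  {s} eq = cong (1ℚ *_) (≡.trans
      (solve 1 (λ s → s := con 1ℚ :+ s :- con 1ℚ) refl s)
      (≡.trans (cong (_- 1ℚ) (≡.sym eq)) (solve 1 (λ s → con 1ℚ :+ s :- con 1ℚ := s) refl (fromℕ M))))

  pendent-deg : ∀ u → 𝟙 (pendent G u) * fromℕ (deg G u) ≡ 𝟙 (pendent G u)
  pendent-deg u = go (pendent G u) (pendent⇒deg≡1 G)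
    where
    go : ∀ p → (p ≡ true → deg G u ≡ 1) → 𝟙 p * fromℕ (deg G u) ≡ 𝟙 p
    go true  d = ≡.trans (ℚ.*-identityˡ _) (cong fromℕ (d refl))
    go false d = ℚ.*-zeroˡ (fromℕ (deg G u))

  sum-pendent-adj : ∑[ u < n ] ∑[ v < n ] (𝟙 (pendent G u) * 𝟙 (adj G u v)) ≡ fromℕ k
  sum-pendent-adj = ≡.trans (sum-cong-≗ λ u →
    ≡.trans (≡.sym (*-distribˡ-sum (𝟙 (pendent G u)) (𝟙 ∘ adj G u)))
      (≡.trans (cong (𝟙 (pendent G u) *_) (≡.sym (degℚ G u))) (pendent-deg u))) sum-pendent

  sum-adj-pendent : ∑[ u < n ] ∑[ v < n ] (𝟙 (adj G u v) * 𝟙 (pendent G v)) ≡ fromℕ k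
  sum-adj-pendent = ≡.trans (∑-comm {n} {n} (λ u v → 𝟙 (adj G u v) * 𝟙 (pendent G v)))
    (≡.trans (sum-cong-≗ λ v → sum-cong-≗ λ u →
      ≡.trans (ℚ.*-comm (𝟙 (adj G u v)) (𝟙 (pendent G v)))
              (cong (λ a → 𝟙 (pendent G v) * 𝟙 a) (Graph.sym G u v)))
      sum-pendent-adj)

  -- The three rationals are unconstrained because `sum-edgeBound` is an identity. It is applied to
  -- upper approximations for the inequality and to lower ones for attainment.
  module Weighted (W : CoreWeights G) (Q q₂ q₃ : ℚ) where
    open CoreWeights W
    open +-*-Solver

    coreBound : Fin n → Fin n → ℚ
    coreBound u v = (1ℚ - (w u + w v)) * Q + (w u + w v) * q₃

    edgeBound : Fin n → Fin n → ℚ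
    edgeBound u v = pairBound (adj G u v) (pendent G u) (pendent G v) (u ≠ᵇ v) q₂ (coreBound u v)

    private
      P C : Fin n → ℚ
      P u = 𝟙 (pendent G u)
      C u = 𝟙 (core G u)
      A D : Fin n → Fin n → ℚ
      A u v = 𝟙 (adj G u v)
      D u v = 𝟙 (u ≠ᵇ v)
      m : ℚ
      m = fromℕ M

    edgeBound-sym : ∀ u v → edgeBound u v ≡ edgeBound v u
    edgeBound-sym u v = ≡.trans
      (cong₂ (λ a d → pairBound a (pendent G u) (pendent G v) d q₂ (coreBound u v)) (Graph.sym G u v) (≠ᵇ-sym u v))
      (solve 11 (λ a p p′ c c′ d x y Q q₂ q₃ →
         a :* (p :+ p′) :* q₂ :+ c :* c′ :* d :* ((con 1ℚ :- (x :+ y)) :* Q :+ (x :+ y) :* q₃)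
         := a :* (p′ :+ p) :* q₂ :+ c′ :* c :* d :* ((con 1ℚ :- (y :+ x)) :* Q :+ (y :+ x) :* q₃)) refl
         (A v u) (P u) (P v) (C u) (C v) (D v u) (w u) (w v) Q q₂ q₃)

    edgeBound-diag : ∀ u → edgeBound u u ≡ 0ℚ
    edgeBound-diag u = ≡.trans
      (cong₂ (λ a d → pairBound a (pendent G u) (pendent G u) d q₂ (coreBound u u)) (irrefl G u) (≠ᵇ-irrefl u))
      (solve 4 (λ p c q B → con 0ℚ :* (p :+ p) :* q :+ c :* c :* con 0ℚ :* B := con 0ℚ) refl
         (P u) (C u) q₂ (coreBound u u))

    private
      rest-w : ∀ u → ∑[ v < n ] (D u v * w v) ≡ 1ℚ - w u
      rest-w u = ≡.trans
        (solve 2 (λ x s → s := x :+ s :- x) refl (w u) (∑[ v < n ] (D u v * w v)))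
        (cong (_- w u) (≡.trans (≡.sym (sum-split w u)) sum-w))

      pendentRow : Fin n → ℚ
      pendentRow u = ∑[ v < n ] (q₂ * (P u * A u v) + q₂ * (A u v * P v))

      coreRow : Fin n → ℚ
      coreRow u = ∑[ v < n ] (C u * C v * D u v * coreBound u v)

      -- The other weights enter the row of `u` linearly and add up to `1ℚ - w u`, so the row
      -- depends on the weights through `w u` alone.
      coreRow-value : ∀ u → coreRow u ≡ (m * Q + q₃ - Q) * C u + (m - 1ℚ) * (q₃ - Q) * w u
      coreRow-value u = begin
        coreRow u
          ≡⟨ sum-cong-≗ (λ v → ≡.trans
               (solve 7 (λ c c′ d x y Q q₃ →
                 c :* c′ :* d :* ((con 1ℚ :- (x :+ y)) :* Q :+ (x :+ y) :* q₃)
                 := c :* ((con 1ℚ :- x) :* Q :+ x :* q₃) :* (d :* c′) :+ c :* (q₃ :- Q) :* (d :* (c′ :* y)))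
                 refl (C u) (C v) (D u v) (w u) (w v) Q q₃)
               (cong (λ y → α * (D u v * C v) + β * (D u v * y)) (w-supported v))) ⟩
        (∑[ v < n ] (α * (D u v * C v) + β * (D u v * w v)))
          ≡⟨ sum-linear α β (λ v → D u v * C v) (λ v → D u v * w v) ⟩
        α * sC + β * (∑[ v < n ] (D u v * w v))
          ≡⟨ cong (λ s → α * sC + β * s) (rest-w u) ⟩
        α * sC + β * (1ℚ - w u)
          ≡⟨ solve 5 (λ c s x Q q₃ →
               c :* ((con 1ℚ :- x) :* Q :+ x :* q₃) :* s :+ c :* (q₃ :- Q) :* (con 1ℚ :- x)
               := ((con 1ℚ :- x) :* Q :+ x :* q₃) :* (c :* s) :+ c :* (q₃ :- Q) :* (con 1ℚ :- x))
               refl (C u) sC (w u) Q q₃ ⟩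
        ((1ℚ - w u) * Q + w u * q₃) * (C u * sC) + β * (1ℚ - w u)
          ≡⟨ cong (λ s → ((1ℚ - w u) * Q + w u * q₃) * s + β * (1ℚ - w u)) (other-core u) ⟩
        ((1ℚ - w u) * Q + w u * q₃) * (C u * m) + β * (1ℚ - w u)
          ≡⟨ solve 5 (λ c m x Q q₃ →
               ((con 1ℚ :- x) :* Q :+ x :* q₃) :* (c :* m) :+ c :* (q₃ :- Q) :* (con 1ℚ :- x)
               := (m :* Q :+ q₃ :- Q) :* c :+ (m :- con 1ℚ) :* (q₃ :- Q) :* (c :* x))
               refl (C u) m (w u) Q q₃ ⟩
        (m * Q + q₃ - Q) * C u + (m - 1ℚ) * (q₃ - Q) * (C u * w u)
          ≡⟨ cong (λ x → (m * Q + q₃ - Q) * C u + (m - 1ℚ) * (q₃ - Q) * x) (w-supported u) ⟩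
        (m * Q + q₃ - Q) * C u + (m - 1ℚ) * (q₃ - Q) * w u ∎
        where
        open ≡.≡-Reasoning
        α β sC : ℚ
        α  = C u * ((1ℚ - w u) * Q + w u * q₃)
        β  = C u * (q₃ - Q)
        sC = ∑[ v < n ] (D u v * C v)

    -- Over ordered pairs: a core vertex lies in 2M of the (M + 1) M ordered core pairs, so the sums
    -- w(u) + w(v) total 2M. This is the coefficient of `q₃`, and (M - 1) M remains for `Q`.
    sum-edgeBound : ∑[ u < n ] ∑[ v < n ] edgeBound u v ≡
      (q₂ * fromℕ k + q₂ * fromℕ k) + ((m - 1ℚ) * m * Q + (m + m) * q₃)
    sum-edgeBound = begin
      (∑[ u < n ] ∑[ v < n ] edgeBound u v)
        ≡⟨ sum-cong-≗ (λ u → ≡.trans (sum-cong-≗ (split u))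
             (∑-distrib-+ {n} (λ v → q₂ * (P u * A u v) + q₂ * (A u v * P v)) _)) ⟩
      (∑[ u < n ] (pendentRow u + coreRow u))
        ≡⟨ ∑-distrib-+ pendentRow coreRow ⟩
      sum pendentRow + sum coreRow
        ≡⟨ cong₂ _+_ pendentTotal coreTotal ⟩
      (q₂ * fromℕ k + q₂ * fromℕ k) + ((m - 1ℚ) * m * Q + (m + m) * q₃) ∎
      where
      open ≡.≡-Reasoning
      split : ∀ u v → edgeBound u v ≡ (q₂ * (P u * A u v) + q₂ * (A u v * P v)) + C u * C v * D u v * coreBound u v
      split u v = cong (_+ C u * C v * D u v * coreBound u v)
        (solve 4 (λ a p p′ q → a :* (p :+ p′) :* q := q :* (p :* a) :+ q :* (a :* p′)) refl (A u v) (P u) (P v) q₂)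
      pendentTotal : sum pendentRow ≡ q₂ * fromℕ k + q₂ * fromℕ k
      pendentTotal = ≡.trans
        (sum-cong-≗ λ u → sum-linear q₂ q₂ (λ v → P u * A u v) (λ v → A u v * P v))
        (≡.trans (sum-linear q₂ q₂ (λ u → ∑[ v < n ] (P u * A u v)) (λ u → ∑[ v < n ] (A u v * P v)))
          (cong₂ (λ s t → q₂ * s + q₂ * t) sum-pendent-adj sum-adj-pendent))
      coreTotal : sum coreRow ≡ (m - 1ℚ) * m * Q + (m + m) * q₃
      coreTotal = ≡.trans (sum-cong-≗ coreRow-value)
        (≡.trans (sum-linear (m * Q + q₃ - Q) ((m - 1ℚ) * (q₃ - Q)) C w)
          (≡.trans (cong₂ (λ s t → (m * Q + q₃ - Q) * s + (m - 1ℚ) * (q₃ - Q) * t) sum-core sum-w)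
            (solve 3 (λ m Q q₃ → (m :* Q :+ q₃ :- Q) :* (con 1ℚ :+ m) :+ (m :- con 1ℚ) :* (q₃ :- Q) :* con 1ℚ
              := (m :- con 1ℚ) :* m :* Q :+ (m :+ m) :* q₃) refl m Q q₃)))

-- Contribution of a pair of vertices

false≢true : false ≢ true
false≢true ()

-- f′ says whether v has degree n - 1 (and f, in penalty, whether u does).
deficient : (a p p′ d f′ : Bool) → Bool
deficient a p p′ d f′ = (a ∧ p ∧ not f′) ∨ (not a ∧ not p ∧ not p′ ∧ d)

-- A missing core pair is deficient in both orientations and is charged ½ out of a bound of at least
-- 1. A pendent edge at a vertex of degree below n - 1 is deficient only as seen from its pendent
-- end and is charged ¼ out of the ½ that `pendent-radical` provides. The common factor ¼ makes the
-- total charge a multiple of `deficiency`.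
penalty : (a p p′ d f f′ : Bool) → ℚ
penalty a p p′ d f f′ = ½ * ½ * (𝟙 (deficient a p p′ d f′) + 𝟙 (deficient a p′ p d f))

module _ {q B : ℚ} where
  open +-*-Solver
  open ≤-Reasoning

  edge-case : ∀ p p′ d f f′ {t} → d ≡ true → ¬ (p ≡ true × p′ ≡ true) →
              (p ≡ true → t + ½ * 𝟙 (not f′) ≤ q) → (p′ ≡ true → t + ½ * 𝟙 (not f) ≤ q) →
              (p ≡ false → p′ ≡ false → t ≤ B) →
              t ≤ pairBound true p p′ d q B - penalty true p p′ d f f′
  edge-case true  true  d f f′ d≡ ¬pp _ _ _ = contradiction (refl , refl) ¬pp
  edge-case true  false .true f true {t} refl _ pend _ _ = begin
    t                ≡⟨ solve 1 (λ t → t := t :+ con ½ :* con 0ℚ) refl t ⟩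
    t + ½ * 0ℚ       ≤⟨ pend refl ⟩
    q                ≡⟨ solve 2 (λ q B → q := con 1ℚ :* (con 1ℚ :+ con 0ℚ) :* q :+ con 0ℚ :* con 1ℚ :* con 1ℚ :* B
                          :- con ½ :* con ½ :* (con 0ℚ :+ con 0ℚ)) refl q B ⟩
    _                ∎
  edge-case true  false .true f false {t} refl _ pend _ _ = begin
    t                ≤⟨ ≤-by-difference (0≤p*q 0≤½ 0≤½) (solve 1 (λ t → t :+ con ½ :* con 1ℚ :- con ½ :* con ½ :- t := con ½ :* con ½) refl t) ⟩
    t + ½ * 1ℚ - ½ * ½  ≤⟨ ℚ.+-monoˡ-≤ _ (pend refl) ⟩
    q - ½ * ½           ≡⟨ solve 2 (λ q B → q :- con ½ :* con ½ := con 1ℚ :* (con 1ℚ :+ con 0ℚ) :* q :+ con 0ℚ :* con 1ℚ :* con 1ℚ :* B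
                          :- con ½ :* con ½ :* (con 1ℚ :+ con 0ℚ)) refl q B ⟩
    _                ∎
  edge-case false true  .true true f′ {t} refl _ _ pend _ = begin
    t                ≡⟨ solve 1 (λ t → t := t :+ con ½ :* con 0ℚ) refl t ⟩
    t + ½ * 0ℚ       ≤⟨ pend refl ⟩
    q                ≡⟨ solve 2 (λ q B → q := con 1ℚ :* (con 0ℚ :+ con 1ℚ) :* q :+ con 1ℚ :* con 0ℚ :* con 1ℚ :* B
                          :- con ½ :* con ½ :* (con 0ℚ :+ con 0ℚ)) refl q B ⟩
    _                ∎
  edge-case false true  .true false f′ {t} refl _ _ pend _ = begin
    t                ≤⟨ ≤-by-difference (0≤p*q 0≤½ 0≤½) (solve 1 (λ t → t :+ con ½ :* con 1ℚ :- con ½ :* con ½ :- t := con ½ :* con ½) refl t) ⟩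
    t + ½ * 1ℚ - ½ * ½  ≤⟨ ℚ.+-monoˡ-≤ _ (pend refl) ⟩
    q - ½ * ½           ≡⟨ solve 2 (λ q B → q :- con ½ :* con ½ := con 1ℚ :* (con 0ℚ :+ con 1ℚ) :* q :+ con 1ℚ :* con 0ℚ :* con 1ℚ :* B
                          :- con ½ :* con ½ :* (con 0ℚ :+ con 1ℚ)) refl q B ⟩
    _                ∎
  edge-case false false .true f f′ {t} refl _ _ _ core = begin
    t                ≤⟨ core refl refl ⟩
    B                ≡⟨ solve 2 (λ q B → B := con 1ℚ :* (con 0ℚ :+ con 0ℚ) :* q :+ con 1ℚ :* con 1ℚ :* con 1ℚ :* B
                          :- con ½ :* con ½ :* (con 0ℚ :+ con 0ℚ)) refl q B ⟩
    _                ∎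

  nonedge-case : ∀ p p′ d f f′ → (p ≡ false → p′ ≡ false → d ≡ true → 1ℚ ≤ B) →
                 0ℚ ≤ pairBound false p p′ d q B - penalty false p p′ d f f′
  nonedge-case true p′ d f f′ _ = ℚ.≤-reflexive (go p′)
    where
    go : ∀ p′ → 0ℚ ≡ pairBound false true p′ d q B - penalty false true p′ d f f′
    go true  = solve 3 (λ q d B → con 0ℚ := con 0ℚ :* (con 1ℚ :+ con 1ℚ) :* q :+ con 0ℚ :* con 0ℚ :* d :* B
                          :- con ½ :* con ½ :* (con 0ℚ :+ con 0ℚ)) refl q (𝟙 d) B
    go false = solve 3 (λ q d B → con 0ℚ := con 0ℚ :* (con 1ℚ :+ con 0ℚ) :* q :+ con 0ℚ :* con 1ℚ :* d :* B
                          :- con ½ :* con ½ :* (con 0ℚ :+ con 0ℚ)) refl q (𝟙 d) B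
  nonedge-case false true d f f′ _ = ℚ.≤-reflexive
    (solve 3 (λ q d B → con 0ℚ := con 0ℚ :* (con 0ℚ :+ con 1ℚ) :* q :+ con 1ℚ :* con 0ℚ :* d :* B
                          :- con ½ :* con ½ :* (con 0ℚ :+ con 0ℚ)) refl q (𝟙 d) B)
  nonedge-case false false false f f′ _ = ℚ.≤-reflexive
    (solve 2 (λ q B → con 0ℚ := con 0ℚ :* (con 0ℚ :+ con 0ℚ) :* q :+ con 1ℚ :* con 1ℚ :* con 0ℚ :* B
                          :- con ½ :* con ½ :* (con 0ℚ :+ con 0ℚ)) refl q B)
  nonedge-case false false true f f′ core = ≤-by-difference
    (0≤p+q 0≤½ (p≤q⇒0≤q-p (core refl refl refl)))
    (solve 2 (λ q B → con 0ℚ :* (con 0ℚ :+ con 0ℚ) :* q :+ con 1ℚ :* con 1ℚ :* con 1ℚ :* B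
                          :- con ½ :* con ½ :* (con 1ℚ :+ con 1ℚ) :- con 0ℚ := con ½ :+ (B :- con 1ℚ)) refl q B)

  tight-edge-case : ∀ p p′ d {t} → d ≡ true → ¬ (p ≡ true × p′ ≡ true) →
                    (p ≡ true → q ≤ t) → (p′ ≡ true → q ≤ t) →
                    (p ≡ false → p′ ≡ false → B ≤ t) →
                    pairBound true p p′ d q B ≤ t
  tight-edge-case true  true  d d≡ ¬pp _ _ _ = contradiction (refl , refl) ¬pp
  tight-edge-case true  false .true refl _ pend _ _ = subst (_≤ _)
    (solve 2 (λ q B → q := con 1ℚ :* (con 1ℚ :+ con 0ℚ) :* q :+ con 0ℚ :* con 1ℚ :* con 1ℚ :* B) refl q B) (pend refl)
  tight-edge-case false true  .true refl _ _ pend _ = subst (_≤ _)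
    (solve 2 (λ q B → q := con 1ℚ :* (con 0ℚ :+ con 1ℚ) :* q :+ con 1ℚ :* con 0ℚ :* con 1ℚ :* B) refl q B) (pend refl)
  tight-edge-case false false .true refl _ _ _ core = subst (_≤ _)
    (solve 2 (λ q B → B := con 1ℚ :* (con 0ℚ :+ con 0ℚ) :* q :+ con 1ℚ :* con 1ℚ :* con 1ℚ :* B) refl q B) (core refl refl)

  tight-nonedge-case : ∀ p p′ d → ¬ (p ≡ false × p′ ≡ false × d ≡ true) → pairBound false p p′ d q B ≤ 0ℚ
  tight-nonedge-case p p′ d ¬core = ℚ.≤-reflexive (≡.trans
    (cong (λ z → 0ℚ * (𝟙 p + 𝟙 p′) * q + z * B) (go p p′ d ¬core))
    (solve 3 (λ s q B → con 0ℚ :* s :* q :+ con 0ℚ :* B := con 0ℚ) refl (𝟙 p + 𝟙 p′) q B))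
    where
    go : ∀ p p′ d → ¬ (p ≡ false × p′ ≡ false × d ≡ true) → 𝟙 (not p) * 𝟙 (not p′) * 𝟙 d ≡ 0ℚ
    go true  true  true  _ = refl
    go true  true  false _ = refl
    go true  false true  _ = refl
    go true  false false _ = refl
    go false true  true  _ = refl
    go false true  false _ = refl
    go false false true  ¬core = contradiction (refl , refl , refl) ¬core
    go false false false _ = refl

-- The bound as a function of `M` and `k`

boundTerms : ℕ → ℕ → RadSum
boundTerms M k =
  ((M ℕ.∸ 1) ℕ.* M ℕ.^ 2 , ½) ∷
  (k , fromℕ ((M ℕ.+ k) ℕ.^ 2 ℕ.+ 1)) ∷
  (M , fromℕ ((M ℕ.+ k) ℕ.^ 2 ℕ.+ M ℕ.^ 2)) ∷ []

bound≡boundTerms : ∀ M k → bound (suc (M ℕ.+ k)) k ≡ boundTerms M k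
bound≡boundTerms M k = cong
  (λ m → ((m ℕ.∸ 2) ℕ.* (m ℕ.∸ 1) ℕ.^ 2 , ½) ∷ (k , fromℕ ((M ℕ.+ k) ℕ.^ 2 ℕ.+ 1)) ∷
         (m ℕ.∸ 1 , fromℕ ((M ℕ.+ k) ℕ.^ 2 ℕ.+ (m ℕ.∸ 1) ℕ.^ 2)) ∷ [])
  (ℕ.m+n∸n≡m (suc M) k)

-- For `M = 0` the truncated predecessor is 0 and the rational one is -1, but the factor M² makes
-- both sides vanish.
fromℕ-clique : ∀ M → fromℕ ((M ℕ.∸ 1) ℕ.* M ℕ.^ 2) ≡ (fromℕ M - 1ℚ) * fromℕ M * fromℕ M
fromℕ-clique zero    = refl
fromℕ-clique (suc M) = ≡.trans (fromℕ-* M (suc M ℕ.^ 2))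
  (≡.trans (cong₂ _*_ M≡ (fromℕ-² (suc M))) (≡.sym (ℚ.*-assoc (fromℕ (suc M) - 1ℚ) (fromℕ (suc M)) (fromℕ (suc M)))))
  where
  open +-*-Solver
  M≡ : fromℕ M ≡ fromℕ (suc M) - 1ℚ
  M≡ = ≡.trans (solve 1 (λ x → x := con 1ℚ :+ x :- con 1ℚ) refl (fromℕ M)) (cong (_- 1ℚ) (≡.sym (fromℕ-+ 1 M)))

-- The clique radical √½ is used as  2 M √½ = √(2 M²),  the length of (M , M).
boundValue : ℕ → ℕ → (q₁ q₂ q₃ : ℚ) → ℚ
boundValue M k q₁ q₂ q₃ = fromℕ ((M ℕ.∸ 1) ℕ.* M ℕ.^ 2) * q₁ + (fromℕ k * q₂ + (fromℕ M * q₃ + 0ℚ))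

boundValue-double : ∀ M k q₁ q₂ q₃ → let m = fromℕ M in
  boundValue M k q₁ q₂ q₃ + boundValue M k q₁ q₂ q₃ ≡
  (q₂ * fromℕ k + q₂ * fromℕ k) + ((m - 1ℚ) * m * (m * (q₁ + q₁)) + (m + m) * q₃)
boundValue-double M k q₁ q₂ q₃ = ≡.trans
  (cong (λ c → (c * q₁ + r) + (c * q₁ + r)) (fromℕ-clique M))
  (solve 5 (λ m k q₁ q₂ q₃ → let r = (m :- con 1ℚ) :* m :* m :* q₁ :+ (k :* q₂ :+ (m :* q₃ :+ con 0ℚ)) in
     r :+ r := (q₂ :* k :+ q₂ :* k) :+ ((m :- con 1ℚ) :* m :* (m :* (q₁ :+ q₁)) :+ (m :+ m) :* q₃))
     refl (fromℕ M) (fromℕ k) q₁ q₂ q₃)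
  where
  open +-*-Solver
  r = fromℕ k * q₂ + (fromℕ M * q₃ + 0ℚ)

half-cancel : ∀ {p q} → p + p ≤ q + q → p ≤ q
half-cancel {p} {q} le = ≤-by-difference (0≤p*q 0≤½ (p≤q⇒0≤q-p le))
  (solve 2 (λ p q → q :- p := con ½ :* ((q :+ q) :- (p :+ p))) refl p q)
  where open +-*-Solver

fromℕ-sum² : ∀ a b → fromℕ (a ℕ.^ 2 ℕ.+ b ℕ.^ 2) ≡ fromℕ a * fromℕ a + fromℕ b * fromℕ b
fromℕ-sum² a b = ≡.trans (fromℕ-+ (a ℕ.^ 2) (b ℕ.^ 2)) (cong₂ _+_ (fromℕ-² a) (fromℕ-² b))

-- Permutations of the vertices

≡ᵇ-sym : ∀ a b → (a ≡ᵇ b) ≡ (b ≡ᵇ a)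
≡ᵇ-sym zero    zero    = refl
≡ᵇ-sym zero    (suc b) = refl
≡ᵇ-sym (suc a) zero    = refl
≡ᵇ-sym (suc a) (suc b) = ≡ᵇ-sym a b

𝟙-injective : ∀ a b → 𝟙 a ≡ 𝟙 b → a ≡ b
𝟙-injective true  true  _ = refl
𝟙-injective true  false ()
𝟙-injective false true  ()
𝟙-injective false false _ = refl

toℕ-punchIn-fromℕ : ∀ n (i : Fin n) → toℕ (punchIn (Fin.fromℕ n) i) ≡ toℕ i
toℕ-punchIn-fromℕ (suc n) zero    = refl
toℕ-punchIn-fromℕ (suc n) (suc i) = cong suc (toℕ-punchIn-fromℕ n i)

-- The first vertex stays in front if marked and goes to the last position if not; the others are
-- placed by recursion.
sortingPermutation : ∀ {n} (b : Fin n → Bool) → ∃₂ λ (π : Permutation n n) m →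
                     m ℕ.≤ n × sum (𝟙 ∘ b) ≡ fromℕ m × (∀ i → (toℕ (π ⟨$⟩ʳ i) <ᵇ m) ≡ b i)
sortingPermutation {zero}  b = Perm.id , 0 , ℕ.z≤n , refl , λ ()
sortingPermutation {suc n} b = insertFirst (b zero) refl (sortingPermutation (b ∘ suc))
  where
  insertFirst : ∀ b₀ → b zero ≡ b₀ →
    (∃₂ λ (π : Permutation n n) m → m ℕ.≤ n × sum (𝟙 ∘ b ∘ suc) ≡ fromℕ m × (∀ i → (toℕ (π ⟨$⟩ʳ i) <ᵇ m) ≡ b (suc i))) →
    ∃₂ λ (π : Permutation (suc n) (suc n)) m → m ℕ.≤ suc n × sum (𝟙 ∘ b) ≡ fromℕ m × (∀ i → (toℕ (π ⟨$⟩ʳ i) <ᵇ m) ≡ b i)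
  insertFirst true eq (π , m , m≤n , count , sorted) =
    Perm.lift₀ π , suc m , ℕ.s≤s m≤n ,
    ≡.trans (cong₂ (λ b s → 𝟙 b + s) eq count) (≡.sym (fromℕ-+ 1 m)) ,
    λ { zero → ≡.sym eq ; (suc i) → sorted i }
  insertFirst false eq (π , m , m≤n , count , sorted) =
    Perm.insert zero (Fin.fromℕ n) π , m , ℕ.m≤n⇒m≤1+n m≤n ,
    ≡.trans (cong₂ (λ b s → 𝟙 b + s) eq count) (ℚ.+-identityˡ (fromℕ m)) ,
    λ { zero    → ≡.trans (cong (_<ᵇ m) (toℕ-fromℕ n)) (≡.trans (<ᵇ-false (ℕ.≤⇒≯ m≤n)) (≡.sym eq))
      ; (suc i) → ≡.trans (cong (_<ᵇ m) (≡.trans (cong toℕ (Perm.insert-punchIn zero (Fin.fromℕ n) π i))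
                                                 (toℕ-punchIn-fromℕ n (π ⟨$⟩ʳ i)))) (sorted i) }

count-below : ∀ {m n} → m ℕ.≤ n → ∑[ i < n ] 𝟙 (toℕ i <ᵇ m) ≡ fromℕ m
count-below {n = n} ℕ.z≤n = sum-replicate-zero n
count-below {suc m} (ℕ.s≤s m≤n) = ≡.trans (cong (1ℚ +_) (count-below m≤n)) (≡.sym (fromℕ-+ 1 m))

-- This lets the hub be swapped into position 0 after sorting, without disturbing the initial
-- segment formed by the core.
transpose-preserves : ∀ {n} (c : Fin n → Bool) {i j} → c i ≡ c j → ∀ k → c (PC.transpose i j k) ≡ c k
transpose-preserves c {i} {j} ci≡cj k with k ≟ i
... | yes refl = ≡.sym ci≡cj
... | no  _ with k ≟ j
...   | yes refl = ci≡cj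
...   | no  _    = refl

to-injective : ∀ {n} (f : Permutation n n) {u v} → f ⟨$⟩ʳ u ≡ f ⟨$⟩ʳ v → u ≡ v
to-injective f {u} {v} eq = ≡.trans (≡.sym (Perm.inverseˡ f)) (≡.trans (cong (f ⟨$⟩ˡ_) eq) (Perm.inverseˡ f))

≡ᵇ-reflects-≡ : ∀ {n} (f : Permutation n n) u v → (toℕ (f ⟨$⟩ʳ u) ≡ᵇ toℕ (f ⟨$⟩ʳ v)) ≡ does (u ≟ v)
≡ᵇ-reflects-≡ f u v with u ≟ v
... | yes refl = ≡ᵇ-complete {toℕ (f ⟨$⟩ʳ u)} refl
... | no u≢v   = ¬-not λ eq → u≢v (to-injective f (toℕ-injective (≡ᵇ-sound _ _ eq)))

-- Adjacency of u and v in KPendent: e is u = v, cu and cv say that u and v lie in the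
-- clique, hu and hv that they are the vertex carrying the pendent edges.
hubAdj : (e cu cv hu hv : Bool) → Bool
hubAdj e cu cv hu hv = not e ∧ ((cu ∧ cv) ∨ ((hu ∧ not cv) ∨ (hv ∧ not cu)))

transpose-first : ∀ {n} (i j : Fin n) → PC.transpose i j i ≡ j
transpose-first i j rewrite dec-true (i ≟ i) refl = refl

-- Graphs with M + 1 core vertices and k pendent vertices

-- If d < N, then t ≤ N and t² ≤ 1 + (N - 1)², so (t + ½)² ≤ N² - N + 9/4, which is below N² + 1
-- once N ≥ 2. A pendent edge at a vertex of degree below N thus falls short by at least ½.
pendent-radical : ∀ {d N q t} → 2 ℕ.≤ N → d ℕ.≤ N → 0ℚ ≤ q → fromℕ N * fromℕ N + 1ℚ ≤ q * q →
                  t * t ≤ 1ℚ + fromℕ d * fromℕ d → t + ½ * 𝟙 (not (d ≡ᵇ N)) ≤ q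
pendent-radical {d} {N} {q} {t} 2≤N d≤N 0≤q hq ht = go (d ≡ᵇ N) refl
  where
  open +-*-Solver
  open ≤-Reasoning
  x y : ℚ
  x = fromℕ d
  y = fromℕ N
  go : ∀ b → (d ≡ᵇ N) ≡ b → t + ½ * 𝟙 (not b) ≤ q
  go true  _ = begin
    t + ½ * 0ℚ    ≡⟨ solve 1 (λ t → t :+ con ½ :* con 0ℚ := t) refl t ⟩
    t             ≤⟨ square-cancel-≤ 0≤q (begin
      t * t             ≤⟨ ht ⟩
      1ℚ + x * x        ≤⟨ ℚ.+-monoʳ-≤ 1ℚ (square-mono-≤ (0≤fromℕ d) (fromℕ-mono-≤ d≤N)) ⟩
      1ℚ + y * y        ≡⟨ ℚ.+-comm 1ℚ (y * y) ⟩
      y * y + 1ℚ        ≤⟨ hq ⟩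
      q * q             ∎) ⟩
    q             ∎
  go false d≢ᵇN = square-cancel-≤ 0≤q (≤-by-difference
    (0≤p+q (0≤p+q (0≤p+q (0≤p+q (0≤p+q
      (p≤q⇒0≤q-p hq) (p≤q⇒0≤q-p ht)) (p≤q⇒0≤q-p (square-mono-≤ (0≤fromℕ d) x≤y-1)))
      (p≤q⇒0≤q-p t≤y)) (p≤q⇒0≤q-p (fromℕ-mono-≤ 2≤N))) (0≤p+q 0≤½ (0≤p*q 0≤½ 0≤½)))
    (solve 4 (λ q t x y →
      q :* q :- (t :+ con ½ :* con 1ℚ) :* (t :+ con ½ :* con 1ℚ)
      := (q :* q :- (y :* y :+ con 1ℚ)) :+ (con 1ℚ :+ x :* x :- t :* t)
         :+ ((y :- con 1ℚ) :* (y :- con 1ℚ) :- x :* x) :+ (y :- t) :+ (y :- con (fromℕ 2))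
         :+ (con ½ :+ con ½ :* con ½)) refl q t x y))
    where
    d≢N : d ≢ N
    d≢N d≡N with ≡.trans (≡.sym (≡ᵇ-complete d≡N)) d≢ᵇN
    ... | ()
    1+x≤y : 1ℚ + x ≤ y
    1+x≤y = subst (_≤ y) (fromℕ-+ 1 d) (fromℕ-mono-≤ (ℕ.≤∧≢⇒< d≤N d≢N))
    x≤y-1 : x ≤ y - 1ℚ
    x≤y-1 = ≤-by-difference (p≤q⇒0≤q-p 1+x≤y)
      (solve 2 (λ x y → y :- con 1ℚ :- x := y :- (con 1ℚ :+ x)) refl x y)
    t≤y : t ≤ y
    t≤y = square-cancel-≤ (0≤fromℕ N) (begin
      t * t                    ≤⟨ ht ⟩
      1ℚ + x * x               ≤⟨ ≤-by-difference (0≤p+q (0≤fromℕ d) (0≤fromℕ d))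
                                    (solve 1 (λ x → (con 1ℚ :+ x) :* (con 1ℚ :+ x) :- (con 1ℚ :+ x :* x) := x :+ x) refl x) ⟩
      (1ℚ + x) * (1ℚ + x)      ≤⟨ square-mono-≤ (0≤p+q (0≤fromℕ 1) (0≤fromℕ d)) 1+x≤y ⟩
      y * y                    ∎)

module Setting {n} (G : Graph n) (M k : ℕ) (order : n ≡ suc (M ℕ.+ k)) (2≤N : 2 ℕ.≤ M ℕ.+ k)
  (sum-pendent : sum (𝟙 ∘ pendent G) ≡ fromℕ k)
  (sum-core : sum (𝟙 ∘ core G) ≡ 1ℚ + fromℕ M)
  (nonadjacent : ∀ u v → pendent G u ≡ true → pendent G v ≡ true → adj G u v ≢ true) where

  open Totals G M k sum-pendent sum-core
  open +-*-Solver

  N : ℕ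
  N = M ℕ.+ k

  dominating : Fin n → Bool
  dominating v = deg G v ≡ᵇ N

  sum-others : ∀ u → ∑[ v < n ] 𝟙 (u ≠ᵇ v) ≡ fromℕ N
  sum-others u = begin
    (∑[ v < n ] 𝟙 (u ≠ᵇ v))                        ≡⟨ sum-cong-≗ (λ v → ≡.sym (ℚ.*-identityʳ (𝟙 (u ≠ᵇ v)))) ⟩
    s                                              ≡⟨ solve 1 (λ s → s := con 1ℚ :+ s :- con 1ℚ) refl s ⟩
    1ℚ + s - 1ℚ                                    ≡⟨ cong (_- 1ℚ) (≡.trans (≡.sym (sum-split (λ _ → 1ℚ) u)) (sum-ones n)) ⟩
    fromℕ n - 1ℚ                                   ≡⟨ cong (_- 1ℚ) (≡.trans (cong fromℕ order) (fromℕ-+ 1 N)) ⟩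
    1ℚ + fromℕ N - 1ℚ                              ≡⟨ solve 1 (λ s → con 1ℚ :+ s :- con 1ℚ := s) refl (fromℕ N) ⟩
    fromℕ N                                        ∎
    where
    open ≡.≡-Reasoning
    s = ∑[ v < n ] (𝟙 (u ≠ᵇ v) * 1ℚ)

  deg≤N : ∀ u → deg G u ℕ.≤ N
  deg≤N u = fromℕ-cancel-≤ (begin
    fromℕ (deg G u)                 ≡⟨ degℚ G u ⟩
    (∑[ v < n ] 𝟙 (adj G u v))      ≤⟨ sum-mono-≤ (adj≤≠ᵇ G u) ⟩
    (∑[ v < n ] 𝟙 (u ≠ᵇ v))         ≡⟨ sum-others u ⟩
    fromℕ N                         ∎)
    where open ≤-Reasoning

  1≤M : ∀ {u v} → core G u ≡ true → core G v ≡ true → u ≢ v → 1ℚ ≤ fromℕ M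
  1≤M {u} {v} cu cv u≢v = ≤-by-difference (p≤q⇒0≤q-p two≤)
    (solve 1 (λ m → m :- con 1ℚ := con 1ℚ :+ m :- (con 1ℚ :+ con 1ℚ)) refl (fromℕ M))
    where
    open ≤-Reasoning
    two≤ : 1ℚ + 1ℚ ≤ 1ℚ + fromℕ M
    two≤ = begin
      1ℚ + 1ℚ                            ≡⟨ cong₂ (λ a b → 𝟙 a + 𝟙 b) cu cv ⟨
      𝟙 (core G u) + 𝟙 (core G v)        ≤⟨ two-terms≤sum {f = 𝟙 ∘ core G} (λ i → 0≤𝟙 (core G i)) u≢v ⟩
      sum (𝟙 ∘ core G)                   ≡⟨ sum-core ⟩
      1ℚ + fromℕ M                       ∎

  N-split : fromℕ N ≡ fromℕ M + fromℕ k
  N-split = fromℕ-+ M k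

  edgeWeight²-value : ∀ u v → edgeWeight² G u v ≡
                      fromℕ (deg G u) * fromℕ (deg G u) + fromℕ (deg G v) * fromℕ (deg G v)
  edgeWeight²-value u v = fromℕ-sum² (deg G u) (deg G v)

  pendent-edgeWeight² : ∀ {u} v → pendent G u ≡ true → edgeWeight² G u v ≡ 1ℚ + fromℕ (deg G v) * fromℕ (deg G v)
  pendent-edgeWeight² {u} v pu = ≡.trans (edgeWeight²-value u v)
    (cong (λ d → fromℕ d * fromℕ d + fromℕ (deg G v) * fromℕ (deg G v)) (pendent⇒deg≡1 G {u} pu))

  edgeWeight²-sym : ∀ u v → edgeWeight² G u v ≡ edgeWeight² G v u
  edgeWeight²-sym u v = cong fromℕ (ℕ.+-comm (deg G u ℕ.^ 2) (deg G v ℕ.^ 2))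

  deficientPair : Fin n → Fin n → Bool
  deficientPair u v = deficient (adj G u v) (pendent G u) (pendent G v) (u ≠ᵇ v) (dominating v)

  deficientPair-flip : ∀ u v → deficientPair v u ≡ deficient (adj G u v) (pendent G v) (pendent G u) (u ≠ᵇ v) (dominating u)
  deficientPair-flip u v = cong₂ (λ a d → deficient a (pendent G v) (pendent G u) d (dominating u)) (Graph.sym G v u) (≠ᵇ-sym v u)

  deficiency : ℚ
  deficiency = ∑[ u < n ] ∑[ v < n ] 𝟙 (deficientPair u v)

  weights-disjoint : (W : CoreWeights G) → ∀ {u v} → u ≢ v → CoreWeights.w W u + CoreWeights.w W v ≤ 1ℚ
  weights-disjoint W u≢v = ℚ.≤-trans (two-terms≤sum 0≤w u≢v) (ℚ.≤-reflexive sum-w)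
    where open CoreWeights W

  module UpperBound (W : CoreWeights G)
    (deg≤ : ∀ u → core G u ≡ true → fromℕ (deg G u) ≤ fromℕ M + fromℕ k * CoreWeights.w W u)
    {q₁ q₂ q₃} (0≤q₁ : 0ℚ ≤ q₁) (0≤q₂ : 0ℚ ≤ q₂) (0≤q₃ : 0ℚ ≤ q₃)
    (h₁ : ½ ≤ q₁ * q₁) (h₂ : fromℕ N * fromℕ N + 1ℚ ≤ q₂ * q₂)
    (h₃ : (fromℕ M + fromℕ k) * (fromℕ M + fromℕ k) + fromℕ M * fromℕ M ≤ q₃ * q₃) where

    open CoreWeights W

    Q : ℚ
    Q = fromℕ M * (q₁ + q₁)

    open Weighted W Q q₂ q₃

    private
      m : ℚ
      m = fromℕ M

    0≤Q : 0ℚ ≤ Q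
    0≤Q = 0≤p*q (0≤fromℕ M) (0≤p+q 0≤q₁ 0≤q₁)

    Q² : m * m + m * m ≤ Q * Q
    Q² = ≤-by-difference (0≤p*q (0≤fromℕ 4) (0≤p*q (0≤square m) (p≤q⇒0≤q-p h₁)))
      (solve 2 (λ m q → m :* (q :+ q) :* (m :* (q :+ q)) :- (m :* m :+ m :* m)
        := con (fromℕ 4) :* (m :* m :* (q :* q :- con ½))) refl m q₁)

    1≤2q₁ : 1ℚ ≤ q₁ + q₁
    1≤2q₁ = square-cancel-≤ (0≤p+q 0≤q₁ 0≤q₁) (≤-by-difference
      (0≤p+q (0≤fromℕ 1) (0≤p*q (0≤fromℕ 4) (p≤q⇒0≤q-p h₁)))
      (solve 1 (λ q → (q :+ q) :* (q :+ q) :- con 1ℚ :* con 1ℚ := con 1ℚ :+ con (fromℕ 4) :* (q :* q :- con ½)) refl q₁))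

    -- `coreBound` is a convex combination of `Q` and `q₃`, and both are at least 1 when M ≥ 1,
    -- which two distinct core vertices guarantee. A missing core edge pays its penalty out of this.
    1≤coreBound : ∀ {u v} → core G u ≡ true → core G v ≡ true → u ≢ v → 1ℚ ≤ coreBound u v
    1≤coreBound {u} {v} cu cv u≢v = ≤-by-difference
      (0≤p+q (0≤p*q (p≤q⇒0≤q-p (weights-disjoint W u≢v)) (p≤q⇒0≤q-p 1≤Q))
             (0≤p*q (0≤p+q (0≤w u) (0≤w v)) (p≤q⇒0≤q-p 1≤q₃)))
      (solve 3 (λ s Q q → (con 1ℚ :- s) :* Q :+ s :* q :- con 1ℚ := (con 1ℚ :- s) :* (Q :- con 1ℚ) :+ s :* (q :- con 1ℚ))
        refl (w u + w v) Q q₃)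
      where
      1≤m : 1ℚ ≤ m
      1≤m = 1≤M cu cv u≢v
      1≤Q : 1ℚ ≤ Q
      1≤Q = ≤-by-difference (0≤p+q (0≤p*q (p≤q⇒0≤q-p 1≤m) (0≤p+q 0≤q₁ 0≤q₁)) (p≤q⇒0≤q-p 1≤2q₁))
        (solve 2 (λ m q → m :* (q :+ q) :- con 1ℚ := (m :- con 1ℚ) :* (q :+ q) :+ (q :+ q :- con 1ℚ)) refl m q₁)
      1≤q₃ : 1ℚ ≤ q₃
      1≤q₃ = square-cancel-≤ 0≤q₃ (ℚ.≤-trans (square-mono-≤ (0≤fromℕ 1) 1≤m)
        (ℚ.≤-trans (≤-by-difference (0≤square (m + fromℕ k))
          (solve 2 (λ x y → x :+ y :- y := x) refl ((m + fromℕ k) * (m + fromℕ k)) (m * m))) h₃))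

    penalizedBound : Fin n → Fin n → ℚ
    penalizedBound u v = edgeBound u v -
      penalty (adj G u v) (pendent G u) (pendent G v) (u ≠ᵇ v) (dominating u) (dominating v)

    edge : ∀ u v → adj G u v ≡ true → ∀ t → t * t ≤ edgeWeight² G u v → t ≤ penalizedBound u v
    edge u v uv t t² = subst
      (λ a → t ≤ pairBound a (pendent G u) (pendent G v) (u ≠ᵇ v) q₂ (coreBound u v)
             - penalty a (pendent G u) (pendent G v) (u ≠ᵇ v) (dominating u) (dominating v)) (≡.sym uv)
      (edge-case (pendent G u) (pendent G v) (u ≠ᵇ v) (dominating u) (dominating v) (≢⇒≠ᵇ u≢v)
        (λ { (pu , pv) → nonadjacent u v pu pv uv })
        (λ pu → pendent-radical {deg G v} {t = t} 2≤N (deg≤N v) 0≤q₂ h₂ (subst (t * t ≤_) (pendent-edgeWeight² v pu) t²))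
        (λ pv → pendent-radical {deg G u} {t = t} 2≤N (deg≤N u) 0≤q₂ h₂
                  (subst (t * t ≤_) (≡.trans (edgeWeight²-sym u v) (pendent-edgeWeight² u pv)) t²))
        (λ pu pv → norm-convex (0≤fromℕ M) (0≤fromℕ k) (0≤w u) (0≤w v) (weights-disjoint W u≢v)
                     0≤Q 0≤q₃ Q² h₃ (0≤fromℕ (deg G u)) (0≤fromℕ (deg G v))
                     (deg≤ u (cong not pu)) (deg≤ v (cong not pv))
                     (subst (t * t ≤_) (edgeWeight²-value u v) t²)))
      where u≢v = adj⇒≢ G uv

    nonedge : ∀ u v → adj G u v ≡ false → 0ℚ ≤ penalizedBound u v
    nonedge u v uv = subst
      (λ a → 0ℚ ≤ pairBound a (pendent G u) (pendent G v) (u ≠ᵇ v) q₂ (coreBound u v)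
             - penalty a (pendent G u) (pendent G v) (u ≠ᵇ v) (dominating u) (dominating v)) (≡.sym uv)
      (nonedge-case (pendent G u) (pendent G v) (u ≠ᵇ v) (dominating u) (dominating v)
        λ pu pv d → 1≤coreBound (cong not pu) (cong not pv) λ { refl → false≢true (≡.trans (≡.sym (≠ᵇ-irrefl u)) d) })

    symmetrized : ∀ u v → penalizedBound u v ≡ edgeBound u v - ½ * ½ * (𝟙 (deficientPair u v) + 𝟙 (deficientPair v u))
    symmetrized u v = cong (λ b → edgeBound u v - ½ * ½ * (𝟙 (deficientPair u v) + 𝟙 b)) (≡.sym (deficientPair-flip u v))

    -- A deficient ordered pair is charged ¼ at (u , v) and ¼ at (v , u), so the full double sum
    -- loses ½ for each unit of `deficiency`.
    upperSum-penalized : upperSum penalizedBound + upperSum penalizedBound ≡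
      (boundValue M k q₁ q₂ q₃ + boundValue M k q₁ q₂ q₃) - ½ * deficiency
    upperSum-penalized = begin
      upperSum penalizedBound + upperSum penalizedBound
        ≡⟨ upperSum-symmetric penalizedBound penalized-sym penalized-diag ⟩
      (∑[ u < n ] ∑[ v < n ] penalizedBound u v)
        ≡⟨ sum-cong-≗ (λ u → ≡.trans (sum-cong-≗ (λ v → ≡.trans (symmetrized u v) (expand (edgeBound u v) (δ u v) (δ v u))))
             (sum-linear 1ℚ c (edgeBound u) (λ v → δ u v + δ v u))) ⟩
      (∑[ u < n ] (1ℚ * sum (edgeBound u) + c * (∑[ v < n ] (δ u v + δ v u))))
        ≡⟨ sum-linear 1ℚ c (λ u → sum (edgeBound u)) (λ u → ∑[ v < n ] (δ u v + δ v u)) ⟩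
      1ℚ * (∑[ u < n ] sum (edgeBound u)) + c * (∑[ u < n ] ∑[ v < n ] (δ u v + δ v u))
        ≡⟨ cong₂ (λ s t → 1ℚ * s + c * t) (≡.trans sum-edgeBound (≡.sym (boundValue-double M k q₁ q₂ q₃))) δ-total ⟩
      1ℚ * (b + b) + c * (deficiency + deficiency)
        ≡⟨ solve 2 (λ b d → con 1ℚ :* (b :+ b) :+ (con 0ℚ :- con ½ :* con ½) :* (d :+ d) := b :+ b :- con ½ :* d) refl b deficiency ⟩
      (b + b) - ½ * deficiency ∎
      where
      open ≡.≡-Reasoning
      b c : ℚ
      b = boundValue M k q₁ q₂ q₃
      c = 0ℚ - ½ * ½
      δ : Fin n → Fin n → ℚ
      δ u v = 𝟙 (deficientPair u v)
      expand : ∀ e x y → e - ½ * ½ * (x + y) ≡ 1ℚ * e + c * (x + y)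
      expand = solve 3 (λ e x y → e :- con ½ :* con ½ :* (x :+ y) := con 1ℚ :* e :+ (con 0ℚ :- con ½ :* con ½) :* (x :+ y)) refl
      δ-total : ∑[ u < n ] ∑[ v < n ] (δ u v + δ v u) ≡ deficiency + deficiency
      δ-total = ≡.trans (sum-cong-≗ λ u → ∑-distrib-+ (δ u) (λ v → δ v u))
        (≡.trans (∑-distrib-+ (λ u → sum (δ u)) (λ u → ∑[ v < n ] δ v u))
          (cong (deficiency +_) (∑-comm {n} {n} (λ u v → δ v u))))
      penalized-sym : ∀ u v → penalizedBound u v ≡ penalizedBound v u
      penalized-sym u v = ≡.trans (symmetrized u v) (≡.trans
        (cong₂ (λ e s → e - ½ * ½ * s) (edgeBound-sym u v) (ℚ.+-comm (δ u v) (δ v u)))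
        (≡.sym (symmetrized v u)))
      penalized-diag : ∀ u → penalizedBound u u ≡ 0ℚ
      penalized-diag u = ≡.trans (symmetrized u u)
        (cong₂ (λ e s → e - ½ * ½ * (𝟙 s + 𝟙 s)) (edgeBound-diag u)
          (≡.trans (cong₂ (λ a d → deficient a (pendent G u) (pendent G u) d (dominating u)) (irrefl G u) (≠ᵇ-irrefl u))
                   (not-deficient (pendent G u))))
        where
        not-deficient : ∀ p → deficient false p p false (dominating u) ≡ false
        not-deficient true  = refl
        not-deficient false = refl

    SO+deficiency≤ : ∀ {x} → Lower (SO G) x → x + ½ * ½ * deficiency ≤ boundValue M k q₁ q₂ q₃
    SO+deficiency≤ {x} lx = half-cancel (≤-by-difference
      (0≤p+q (p≤q⇒0≤q-p x≤) (p≤q⇒0≤q-p x≤))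
      (≡.trans (solve 3 (λ x b d → b :+ b :- ((x :+ con ½ :* con ½ :* d) :+ (x :+ con ½ :* con ½ :* d)) := (b :+ b :- con ½ :* d) :- (x :+ x))
                refl x (boundValue M k q₁ q₂ q₃) deficiency)
        (≡.trans (cong (_- (x + x)) (≡.sym upperSum-penalized))
          (solve 2 (λ s x → s :+ s :- (x :+ x) := s :- x :+ (s :- x)) refl (upperSum penalizedBound) x))))
      where
      x≤ : x ≤ upperSum penalizedBound
      x≤ = Lower-SO G penalizedBound edge nonedge lx

  -- Degrees of core vertices and the choice of weights

  coreNeighbours : ∀ u → core G u ≡ true → ∑[ v < n ] (𝟙 (u ≠ᵇ v) * 𝟙 (core G v)) ≡ fromℕ M
  coreNeighbours u cu = ≡.trans (≡.sym (ℚ.*-identityˡ _)) (≡.trans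
    (subst (λ c → 𝟙 c * (∑[ v < n ] (𝟙 (u ≠ᵇ v) * 𝟙 (core G v))) ≡ 𝟙 c * fromℕ M) cu (other-core u))
    (ℚ.*-identityˡ (fromℕ M)))

  pendentNeighbours : Fin n → ℚ
  pendentNeighbours u = ∑[ v < n ] (𝟙 (adj G u v) * 𝟙 (pendent G v))

  core-deg≤ : ∀ u → core G u ≡ true → fromℕ (deg G u) ≤ fromℕ M + pendentNeighbours u
  core-deg≤ u cu = begin
    fromℕ (deg G u)                                       ≡⟨ degℚ G u ⟩
    (∑[ v < n ] 𝟙 (adj G u v))                            ≤⟨ sum-mono-≤ (λ v → bound-one (adj G u v) (pendent G v) (u ≠ᵇ v) (adj≤≠ᵇ G u v)) ⟩
    (∑[ v < n ] (f v + g v))                              ≡⟨ ∑-distrib-+ f g ⟩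
    sum f + pendentNeighbours u                           ≡⟨ cong (_+ pendentNeighbours u) (coreNeighbours u cu) ⟩
    fromℕ M + pendentNeighbours u                         ∎
    where
    open ≤-Reasoning
    f g : Fin n → ℚ
    f v = 𝟙 (u ≠ᵇ v) * 𝟙 (core G v)
    g v = 𝟙 (adj G u v) * 𝟙 (pendent G v)
    bound-one : ∀ a p d → 𝟙 a ≤ 𝟙 d → 𝟙 a ≤ 𝟙 d * 𝟙 (not p) + 𝟙 a * 𝟙 p
    bound-one a true  d a≤d = ℚ.≤-reflexive (solve 2 (λ a d → a := d :* con 0ℚ :+ a :* con 1ℚ) refl (𝟙 a) (𝟙 d))
    bound-one a false d a≤d = ℚ.≤-trans a≤d (ℚ.≤-reflexive
      (solve 2 (λ a d → d := d :* con 1ℚ :+ a :* con 0ℚ) refl (𝟙 a) (𝟙 d)))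

  pendentNeighbours≤k : ∀ u → pendentNeighbours u ≤ fromℕ k
  pendentNeighbours≤k u = ℚ.≤-trans
    (sum-mono-≤ λ v → go (adj G u v) (pendent G v)) (ℚ.≤-reflexive sum-pendent)
    where
    go : ∀ a p → 𝟙 a * 𝟙 p ≤ 𝟙 p
    go true  p = ℚ.≤-reflexive (ℚ.*-identityˡ (𝟙 p))
    go false p = ℚ.≤-trans (ℚ.≤-reflexive (ℚ.*-zeroˡ (𝟙 p))) (0≤𝟙 p)

  indicatorWeights : ∀ h → core G h ≡ true → CoreWeights G
  indicatorWeights h ch = record
    { w           = indicator h
    ; 0≤w         = λ u → 0≤𝟙 (does (h ≟ u))
    ; sum-w       = sum-indicator h
    ; w-supported = supported
    }
    where
    supported : ∀ u → 𝟙 (core G u) * indicator h u ≡ indicator h u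
    supported u = go (h ≟ u)
      where
      go : (d : Dec (h ≡ u)) → 𝟙 (core G u) * 𝟙 (does d) ≡ 𝟙 (does d)
      go (yes refl) = cong (λ c → 𝟙 c * 1ℚ) ch
      go (no  _)    = ℚ.*-zeroʳ (𝟙 (core G u))

  -- With r = 1/k this is the share of `u` in the pendent vertices. The shares add up to 1 because
  -- the neighbour of a pendent vertex is always core, so restricting to core vertices loses none of
  -- the k incidences.
  pendentWeights : (r : ℚ) → 0ℚ ≤ r → fromℕ k * r ≡ 1ℚ → CoreWeights G
  pendentWeights r 0≤r kr≡1 = record
    { w           = λ u → 𝟙 (core G u) * pendentNeighbours u * r
    ; 0≤w         = λ u → 0≤p*q (0≤p*q (0≤𝟙 (core G u)) (0≤sum (λ v → 0≤p*q (0≤𝟙 (adj G u v)) (0≤𝟙 (pendent G v))))) 0≤r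
    ; sum-w       = total
    ; w-supported = λ u → idem (core G u) (pendentNeighbours u)
    }
    where
    idem : ∀ c a → 𝟙 c * (𝟙 c * a * r) ≡ 𝟙 c * a * r
    idem true  a = ℚ.*-identityˡ (1ℚ * a * r)
    idem false a = solve 2 (λ a r → con 0ℚ :* (con 0ℚ :* a :* r) := con 0ℚ :* a :* r) refl a r
    redundant : ∀ p a p′ → (p ≡ true → p′ ≡ true → a ≢ true) → 𝟙 (not p) * (𝟙 a * 𝟙 p′) ≡ 𝟙 a * 𝟙 p′
    redundant false a     p′    _ = ℚ.*-identityˡ (𝟙 a * 𝟙 p′)
    redundant true  true  true  ¬a = contradiction refl (¬a refl refl)
    redundant true  true  false _ = refl
    redundant true  false true  _ = refl
    redundant true  false false _ = refl
    total : ∑[ u < n ] (𝟙 (core G u) * pendentNeighbours u * r) ≡ 1ℚ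
    total = ≡.trans (≡.sym (*-distribʳ-sum r (λ u → 𝟙 (core G u) * pendentNeighbours u)))
      (≡.trans (cong (_* r) (≡.trans
        (sum-cong-≗ (λ u → ≡.trans (*-distribˡ-sum (𝟙 (core G u)) (λ v → 𝟙 (adj G u v) * 𝟙 (pendent G v)))
          (sum-cong-≗ λ v → redundant (pendent G u) (adj G u v) (pendent G v) (nonadjacent u v))))
        sum-adj-pendent)) kr≡1)

  Balanced : CoreWeights G → Set
  Balanced W = ∀ u → core G u ≡ true → fromℕ (deg G u) ≤ fromℕ M + fromℕ k * CoreWeights.w W u

  balancedWeights : ∀ h → core G h ≡ true → ∃ Balanced
  -- `k` is fixed by the surrounding module, so the distinction is made on a copy tied to it by an
  -- equation. For k = 0 there are no shares, and any weights do because k w(u) vanishes.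
  balancedWeights h ch = go k refl
    where
    open ≤-Reasoning
    go : ∀ k′ → k ≡ k′ → ∃ Balanced
    go zero     k≡0 = indicatorWeights h ch , λ u cu → begin
      fromℕ (deg G u)                      ≤⟨ core-deg≤ u cu ⟩
      fromℕ M + pendentNeighbours u        ≤⟨ ℚ.+-monoʳ-≤ (fromℕ M) (pendentNeighbours≤k u) ⟩
      fromℕ M + fromℕ k                    ≡⟨ cong (fromℕ M +_) (≡.trans (cong fromℕ k≡0) (≡.sym (ℚ.*-zeroˡ (indicator h u)))) ⟩
      fromℕ M + 0ℚ * indicator h u         ≡⟨ cong (λ k → fromℕ M + fromℕ k * indicator h u) k≡0 ⟨
      fromℕ M + fromℕ k * indicator h u    ∎
    go (suc k′) k≡ = pendentWeights r 0≤r kr≡1 , λ u cu → begin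
      fromℕ (deg G u)                      ≤⟨ core-deg≤ u cu ⟩
      fromℕ M + pendentNeighbours u        ≡⟨ cong (fromℕ M +_) (begin-equality
        pendentNeighbours u                                  ≡⟨ ℚ.*-identityˡ _ ⟨
        1ℚ * pendentNeighbours u                             ≡⟨ cong (_* pendentNeighbours u) kr≡1 ⟨
        fromℕ k * r * pendentNeighbours u                    ≡⟨ solve 3 (λ k r a → k :* r :* a := k :* (con 1ℚ :* a :* r)) refl (fromℕ k) r (pendentNeighbours u) ⟩
        fromℕ k * (1ℚ * pendentNeighbours u * r)             ≡⟨ cong (λ c → fromℕ k * (𝟙 c * pendentNeighbours u * r)) cu ⟨
        fromℕ k * (𝟙 (core G u) * pendentNeighbours u * r)   ∎) ⟩
      fromℕ M + fromℕ k * (𝟙 (core G u) * pendentNeighbours u * r) ∎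
      where
      0<k : 0ℚ < fromℕ k
      0<k = ℚ.<-≤-trans (ℚ.positive⁻¹ 1ℚ) (fromℕ-mono-≤ {1} {k} (subst (1 ℕ.≤_) (≡.sym k≡) (ℕ.s≤s ℕ.z≤n)))
      instance
        k-positive = positive 0<k
        k-nonZero  = ℚ.pos⇒nonZero (fromℕ k)
      r : ℚ
      r = 1/ fromℕ k
      0≤r : 0ℚ ≤ r
      0≤r = ℚ.<⇒≤ (ℚ.positive⁻¹ r {{ℚ.1/pos⇒pos (fromℕ k)}})
      kr≡1 : fromℕ k * r ≡ 1ℚ
      kr≡1 = ℚ.*-inverseʳ (fromℕ k)

  -- Deficient pairs and the extremal structure

  1≤deficiency : ∀ {u v} → deficientPair u v ≡ true → 1ℚ ≤ deficiency
  1≤deficiency {u} {v} def = begin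
    1ℚ                                       ≡⟨ cong 𝟙 def ⟨
    𝟙 (deficientPair u v)                    ≤⟨ term≤sum {f = λ v → 𝟙 (deficientPair u v)} (λ v → 0≤𝟙 (deficientPair u v)) v ⟩
    (∑[ v < n ] 𝟙 (deficientPair u v))       ≤⟨ term≤sum {f = λ u → ∑[ v < n ] 𝟙 (deficientPair u v)} (λ u → 0≤sum λ v → 0≤𝟙 (deficientPair u v)) u ⟩
    deficiency                               ∎
    where open ≤-Reasoning

  0≤deficiency : 0ℚ ≤ deficiency
  0≤deficiency = 0≤sum λ u → 0≤sum λ v → 0≤𝟙 (deficientPair u v)

  -- The extremal graph described without numbering its vertices. That every pendent vertex hangs on
  -- the hub is part of `hub-dominates`.
  record Extremal : Set where
    field
      hub           : Fin n
      hub-core      : core G hub ≡ true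
      hub-dominates : ∀ v → hub ≢ v → adj G hub v ≡ true
      core-complete : ∀ u v → core G u ≡ true → core G v ≡ true → u ≢ v → adj G u v ≡ true

  -- Termwise, adjacency to `v` is at most being different from `v`. Degree N makes the two sums
  -- equal, hence all their terms.
  dominating⇒adj : ∀ v → dominating v ≡ true → ∀ x → v ≢ x → adj G v x ≡ true
  dominating⇒adj v dv x v≢x = go (adj G v x) (subst (λ d → 𝟙 d ≤ 𝟙 (adj G v x)) (≢⇒≠ᵇ v≢x)
    (sum-tight {f = λ x → 𝟙 (adj G v x)} {g = λ x → 𝟙 (v ≠ᵇ x)} (adj≤≠ᵇ G v) (ℚ.≤-reflexive (≡.trans (sum-others v)
      (≡.trans (cong fromℕ (≡.sym (≡ᵇ-sound (deg G v) N dv))) (degℚ G v)))) x))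
    where
    go : ∀ a → 1ℚ ≤ 𝟙 a → a ≡ true
    go true  _ = refl
    go false 1≤0 = ⊥-elim (ℕ.1+n≰n (fromℕ-cancel-≤ {1} {0} 1≤0))

  -- If there is a pendent vertex, its neighbour is the hub: with no deficient pair this neighbour
  -- has degree N. Otherwise all vertices are core, the graph is complete, and the given vertex `h`
  -- serves as hub.
  deficient-or-extremal : (∃ λ u → ∃ λ v → adj G u v ≡ true × pendent G u ≡ true) ⊎ (∀ u → core G u ≡ true) →
                          (h : Fin n) → (∃₂ λ u v → deficientPair u v ≡ true) ⊎ Extremal
  deficient-or-extremal pendents h with any? (λ u → any? (λ v → deficientPair u v Bool.≟ true))
  ... | yes (u , v , def) = inj₁ (u , v , def)
  ... | no  ¬def          = inj₂ (extremal pendents)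
    where
    not-deficient : ∀ u v → deficientPair u v ≡ false
    not-deficient u v = ¬-not λ def → ¬def (u , v , def)
    complete : ∀ u v → core G u ≡ true → core G v ≡ true → u ≢ v → adj G u v ≡ true
    complete u v cu cv u≢v = go (adj G u v) (pendent G u) (pendent G v) (u ≠ᵇ v) cu cv (≢⇒≠ᵇ u≢v) (not-deficient u v)
      where
      go : ∀ a p p′ d {f} → not p ≡ true → not p′ ≡ true → d ≡ true → deficient a p p′ d f ≡ false → a ≡ true
      go true  _     _     _    _ _ _ _  = refl
      go false false false true _ _ _ ()
    dominated : ∀ {u v} → adj G u v ≡ true → pendent G u ≡ true → dominating v ≡ true
    dominated {u} {v} uv pu = go (adj G u v) (pendent G u) (pendent G v) (u ≠ᵇ v) (dominating v) uv pu (not-deficient u v)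
      where
      go : ∀ a p p′ d f → a ≡ true → p ≡ true → deficient a p p′ d f ≡ false → f ≡ true
      go true true _ _ true  _ _ _ = refl
      go true true _ _ false _ _ ()
    extremal : _ → Extremal
    extremal (inj₁ (u , v , uv , pu)) = record
      { hub           = v
      ; hub-core      = cong not (¬-not λ pv → nonadjacent u v pu pv uv)
      ; hub-dominates = dominating⇒adj v (dominated uv pu)
      ; core-complete = complete
      }
    extremal (inj₂ all-core) = record
      { hub           = h
      ; hub-core      = all-core h
      ; hub-dominates = λ v → complete h v (all-core h) (all-core v)
      ; core-complete = complete
      }

  -- Attainment of the bound by extremal graphs

  module LowerBound (E : Extremal) {p₁ p₂ p₃} (0≤p₁ : 0ℚ ≤ p₁)
    (h₁ : p₁ * p₁ ≤ ½) (h₂ : p₂ * p₂ ≤ fromℕ N * fromℕ N + 1ℚ)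
    (h₃ : p₃ * p₃ ≤ fromℕ N * fromℕ N + fromℕ M * fromℕ M) where

    open Extremal E
    open ≤-Reasoning

    Q : ℚ
    Q = fromℕ M * (p₁ + p₁)

    -- With all the weight on the hub, `coreBound` is `p₃` on core pairs containing the hub and `Q`
    -- on the others: lower approximations of the lengths these edges have in the extremal graph.
    open Weighted (indicatorWeights hub hub-core) Q p₂ p₃

    private
      m : ℚ
      m = fromℕ M

    Q² : Q * Q ≤ m * m + m * m
    Q² = ≤-by-difference (0≤p*q (0≤fromℕ 4) (0≤p*q (0≤square m) (p≤q⇒0≤q-p h₁)))
      (solve 2 (λ m q → (m :* m :+ m :* m) :- m :* (q :+ q) :* (m :* (q :+ q))
        := con (fromℕ 4) :* (m :* m :* (con ½ :- q :* q))) refl m p₁)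

    deg-hub : deg G hub ≡ N
    deg-hub = fromℕ-injective (≡.trans (degℚ G hub) (≡.trans (sum-cong-≗ same) (sum-others hub)))
      where
      same : ∀ v → 𝟙 (adj G hub v) ≡ 𝟙 (hub ≠ᵇ v)
      same v = go (hub ≟ v)
        where
        go : (d : Dec (hub ≡ v)) → 𝟙 (adj G hub v) ≡ 𝟙 (not (does d))
        go (yes refl) = cong 𝟙 (irrefl G hub)
        go (no h≢v)   = cong 𝟙 (hub-dominates v h≢v)

    deg-core : ∀ u → core G u ≡ true → m ≤ fromℕ (deg G u)
    deg-core u cu = begin
      m                                                 ≡⟨ coreNeighbours u cu ⟨
      (∑[ v < n ] (𝟙 (u ≠ᵇ v) * 𝟙 (core G v)))          ≤⟨ sum-mono-≤ (λ v → covered v (core G v) refl) ⟩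
      (∑[ v < n ] 𝟙 (adj G u v))                        ≡⟨ degℚ G u ⟨
      fromℕ (deg G u)                                   ∎
      where
      covered : ∀ v c → core G v ≡ c → 𝟙 (u ≠ᵇ v) * 𝟙 c ≤ 𝟙 (adj G u v)
      covered v false _  = ℚ.≤-trans (ℚ.≤-reflexive (ℚ.*-zeroʳ (𝟙 (u ≠ᵇ v)))) (0≤𝟙 (adj G u v))
      covered v true  cv = go (u ≟ v)
        where
        go : (d : Dec (u ≡ v)) → 𝟙 (not (does d)) * 1ℚ ≤ 𝟙 (adj G u v)
        go (yes _)  = 0≤𝟙 (adj G u v)
        go (no u≢v) = ℚ.≤-reflexive (cong 𝟙 (≡.sym (core-complete u v cu cv u≢v)))

    pendent-edge : ∀ u v → adj G u v ≡ true → pendent G u ≡ true →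
                   ∀ {q} → 0ℚ ≤ q → edgeWeight² G u v ≤ q * q → p₂ ≤ q
    pendent-edge u v uv pu {q} 0≤q ≤q² = square-cancel-≤ 0≤q (begin
      p₂ * p₂                                   ≤⟨ h₂ ⟩
      fromℕ N * fromℕ N + 1ℚ                    ≡⟨ ℚ.+-comm (fromℕ N * fromℕ N) 1ℚ ⟩
      1ℚ + fromℕ N * fromℕ N                    ≡⟨ cong (λ d → 1ℚ + fromℕ d * fromℕ d) (≡.trans (cong (deg G) v≡hub) deg-hub) ⟨
      1ℚ + fromℕ (deg G v) * fromℕ (deg G v)    ≡⟨ pendent-edgeWeight² v pu ⟨
      edgeWeight² G u v                         ≤⟨ ≤q² ⟩
      q * q                                     ∎)
      where
      hub≢u : hub ≢ u
      hub≢u refl = false≢true (≡.trans (≡.sym (cong not pu)) hub-core)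
      v≡hub : v ≡ hub
      v≡hub = pendent-unique G pu uv (≡.trans (Graph.sym G u hub) (hub-dominates u hub≢u))

    hub-edge : ∀ v → core G v ≡ true → ∀ {q} → 0ℚ ≤ q →
               fromℕ (deg G hub) * fromℕ (deg G hub) + fromℕ (deg G v) * fromℕ (deg G v) ≤ q * q → p₃ ≤ q
    hub-edge v cv {q} 0≤q ≤q² = square-cancel-≤ 0≤q (begin
      p₃ * p₃                                                                    ≤⟨ h₃ ⟩
      fromℕ N * fromℕ N + m * m                                                  ≤⟨ ℚ.+-monoʳ-≤ (fromℕ N * fromℕ N) (square-mono-≤ (0≤fromℕ M) (deg-core v cv)) ⟩
      fromℕ N * fromℕ N + fromℕ (deg G v) * fromℕ (deg G v)                      ≡⟨ cong (λ d → fromℕ d * fromℕ d + fromℕ (deg G v) * fromℕ (deg G v)) deg-hub ⟨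
      fromℕ (deg G hub) * fromℕ (deg G hub) + fromℕ (deg G v) * fromℕ (deg G v)  ≤⟨ ≤q² ⟩
      q * q                                                                      ∎)

    core-edge : ∀ u v → core G u ≡ true → core G v ≡ true → u ≢ v →
                ∀ {q} → 0ℚ ≤ q → edgeWeight² G u v ≤ q * q → coreBound u v ≤ q
    core-edge u v cu cv u≢v {q} 0≤q ≤q² = go (hub ≟ u) (hub ≟ v)
      where
      go : (d : Dec (hub ≡ u)) (d′ : Dec (hub ≡ v)) →
           (1ℚ - (𝟙 (does d) + 𝟙 (does d′))) * Q + (𝟙 (does d) + 𝟙 (does d′)) * p₃ ≤ q
      go (yes refl) (yes refl) = contradiction refl u≢v
      go (yes refl) (no  _)    = subst (_≤ q)
        (solve 2 (λ Q p → p := (con 1ℚ :- (con 1ℚ :+ con 0ℚ)) :* Q :+ (con 1ℚ :+ con 0ℚ) :* p) refl Q p₃)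
        (hub-edge v cv 0≤q (subst (_≤ q * q) (edgeWeight²-value u v) ≤q²))
      go (no _)     (yes refl) = subst (_≤ q)
        (solve 2 (λ Q p → p := (con 1ℚ :- (con 0ℚ :+ con 1ℚ)) :* Q :+ (con 0ℚ :+ con 1ℚ) :* p) refl Q p₃)
        (hub-edge u cu 0≤q (subst (_≤ q * q) (≡.trans (edgeWeight²-sym u v) (edgeWeight²-value v u)) ≤q²))
      go (no _)     (no _)     = subst (_≤ q)
        (solve 2 (λ Q p → Q := (con 1ℚ :- (con 0ℚ :+ con 0ℚ)) :* Q :+ (con 0ℚ :+ con 0ℚ) :* p) refl Q p₃)
        (square-cancel-≤ 0≤q (begin
          Q * Q                                                                  ≤⟨ Q² ⟩
          m * m + m * m                                                          ≤⟨ ℚ.+-mono-≤ (square-mono-≤ (0≤fromℕ M) (deg-core u cu)) (square-mono-≤ (0≤fromℕ M) (deg-core v cv)) ⟩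
          fromℕ (deg G u) * fromℕ (deg G u) + fromℕ (deg G v) * fromℕ (deg G v)  ≡⟨ edgeWeight²-value u v ⟨
          edgeWeight² G u v                                                      ≤⟨ ≤q² ⟩
          q * q                                                                  ∎))

    ≤SO : ∀ {y} → Upper (SO G) y → boundValue M k p₁ p₂ p₃ ≤ y
    ≤SO {y} uy = ℚ.≤-trans (ℚ.≤-reflexive (≡.sym upperSum-edgeBound)) (Upper-SO G edgeBound edge nonedge uy)
      where
      edge : ∀ u v → adj G u v ≡ true → ∀ q → 0ℚ ≤ q → edgeWeight² G u v ≤ q * q → edgeBound u v ≤ q
      edge u v uv q 0≤q ≤q² = subst (λ a → pairBound a (pendent G u) (pendent G v) (u ≠ᵇ v) p₂ (coreBound u v) ≤ q) (≡.sym uv)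
        (tight-edge-case (pendent G u) (pendent G v) (u ≠ᵇ v) (≢⇒≠ᵇ (adj⇒≢ G uv))
          (λ { (pu , pv) → nonadjacent u v pu pv uv })
          (λ pu → pendent-edge u v uv pu 0≤q ≤q²)
          (λ pv → pendent-edge v u (≡.trans (Graph.sym G v u) uv) pv 0≤q (subst (_≤ q * q) (edgeWeight²-sym u v) ≤q²))
          (λ pu pv → core-edge u v (cong not pu) (cong not pv) (adj⇒≢ G uv) 0≤q ≤q²))
      nonedge : ∀ u v → adj G u v ≡ false → edgeBound u v ≤ 0ℚ
      nonedge u v uv = subst (λ a → pairBound a (pendent G u) (pendent G v) (u ≠ᵇ v) p₂ (coreBound u v) ≤ 0ℚ) (≡.sym uv)
        (tight-nonedge-case (pendent G u) (pendent G v) (u ≠ᵇ v) λ { (pu , pv , d) →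
          false≢true (≡.trans (≡.sym uv) (core-complete u v (cong not pu) (cong not pv) λ { refl → false≢true (≡.trans (≡.sym (≠ᵇ-irrefl u)) d) })) })
      upperSum-edgeBound : upperSum edgeBound ≡ boundValue M k p₁ p₂ p₃
      upperSum-edgeBound = ℚ.≤-antisym (half-cancel (ℚ.≤-reflexive double)) (half-cancel (ℚ.≤-reflexive (≡.sym double)))
        where
        double : upperSum edgeBound + upperSum edgeBound ≡ boundValue M k p₁ p₂ p₃ + boundValue M k p₁ p₂ p₃
        double = ≡.trans (upperSum-symmetric edgeBound edgeBound-sym edgeBound-diag)
          (≡.trans sum-edgeBound (≡.sym (boundValue-double M k p₁ p₂ p₃)))

  -- Extremal structure and isomorphism with `KPendent`

  n∸k≡ : n ℕ.∸ k ≡ suc M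
  n∸k≡ = ≡.trans (cong (ℕ._∸ k) order) (ℕ.m+n∸n≡m (suc M) k)

  -- `n` is a successor only through `order`, so vertex 0 is characterised by its value under `toℕ`.
  vertex₀ : ∃ λ (z : Fin n) → toℕ z ≡ 0
  vertex₀ = go order
    where
    go : ∀ {n m} → n ≡ suc m → ∃ λ (z : Fin n) → toℕ z ≡ 0
    go refl = zero , refl

  -- The isomorphism sorts the core to the front and then swaps the hub into position 0. Both
  -- adjacencies are `hubAdj` of five Booleans (equality, core twice, hub twice), and each of these
  -- is preserved.
  Extremal⇒≅ : Extremal → G ≅ KPendent n k
  Extremal⇒≅ E with sortingPermutation (core G)
  ... | π , μ , _ , count , sorted = σ , λ u v → ≡.trans (extremal-adj u v) (≡.sym (cong₂
      (λ e (c : Bool × Bool × Bool × Bool) → hubAdj e (proj₁ c) (proj₁ (proj₂ c)) (proj₁ (proj₂ (proj₂ c))) (proj₂ (proj₂ (proj₂ c))))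
      (≡ᵇ-reflects-≡ σ u v) (cong₂ _,_ (σ-core u) (cong₂ _,_ (σ-core v) (cong₂ _,_ (σ-hub u) (σ-hub v))))))
    where
    open Extremal E
    z : Fin n
    z = proj₁ vertex₀
    σ : Permutation n n
    σ = π Perm.∘ₚ Perm.transpose (π ⟨$⟩ʳ hub) z
    μ≡ : μ ≡ n ℕ.∸ k
    μ≡ = ≡.trans (fromℕ-injective (≡.trans (≡.sym count) (≡.trans sum-core (≡.sym (fromℕ-+ 1 M))))) (≡.sym n∸k≡)
    z-core : (toℕ z <ᵇ μ) ≡ true
    z-core = ≡.trans (cong₂ _<ᵇ_ (proj₂ vertex₀) (≡.trans μ≡ n∸k≡)) refl
    σ-core : ∀ u → (toℕ (σ ⟨$⟩ʳ u) <ᵇ n ℕ.∸ k) ≡ core G u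
    σ-core u = subst (λ m → (toℕ (σ ⟨$⟩ʳ u) <ᵇ m) ≡ core G u) μ≡
      (≡.trans (transpose-preserves (λ i → toℕ i <ᵇ μ) (≡.trans (≡.trans (sorted hub) hub-core) (≡.sym z-core)) (π ⟨$⟩ʳ u)) (sorted u))
    σhub≡0 : toℕ (σ ⟨$⟩ʳ hub) ≡ 0
    σhub≡0 = ≡.trans (cong toℕ (transpose-first (π ⟨$⟩ʳ hub) z)) (proj₂ vertex₀)
    σ-hub : ∀ u → (toℕ (σ ⟨$⟩ʳ u) ≡ᵇ 0) ≡ does (hub ≟ u)
    σ-hub u = ≡.trans (cong (toℕ (σ ⟨$⟩ʳ u) ≡ᵇ_) (≡.sym σhub≡0))
      (≡.trans (≡ᵇ-sym (toℕ (σ ⟨$⟩ʳ u)) _) (≡ᵇ-reflects-≡ σ hub u))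
    extremal-adj : ∀ u v → adj G u v ≡ hubAdj (does (u ≟ v)) (core G u) (core G v) (does (hub ≟ u)) (does (hub ≟ v))
    extremal-adj u v = go (u ≟ v) (hub ≟ u) (hub ≟ v) (pendent G u) (pendent G v) refl refl
      where
      go : (d : Dec (u ≡ v)) (hu : Dec (hub ≡ u)) (hv : Dec (hub ≡ v)) → ∀ pu pv → pendent G u ≡ pu → pendent G v ≡ pv →
           adj G u v ≡ hubAdj (does d) (not pu) (not pv) (does hu) (does hv)
      go (yes refl) _ _ _     _     _  _  = irrefl G u
      go (no u≢v)   _ _ false false eu ev = core-complete u v (cong not eu) (cong not ev) u≢v
      go (no u≢v) (yes refl) _ true _    eu _  = contradiction (≡.trans (≡.sym (cong not eu)) hub-core) false≢true
      go (no u≢v) _ (yes refl) _    true _  ev = contradiction (≡.trans (≡.sym (cong not ev)) hub-core) false≢true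
      go (no u≢v) (no _) (no _)    true  true  eu ev = ¬-not (nonadjacent u v eu ev)
      go (no u≢v) (yes refl) (no _) false true eu ev = hub-dominates v u≢v
      -- The pendent vertex `v` is already adjacent to the hub, so it has no other neighbour.
      go (no u≢v) (no h≢u)  (no h≢v) false true eu ev = ¬-not λ uv →
        h≢u (pendent-unique G ev (≡.trans (Graph.sym G v hub) (hub-dominates v h≢v)) (≡.trans (Graph.sym G v u) uv))
      go (no u≢v) (no _) (yes refl) true false eu ev = ≡.trans (Graph.sym G u v) (hub-dominates u (u≢v ∘ ≡.sym))
      go (no u≢v) (no h≢u)  (no h≢v) true false eu ev = ¬-not λ uv →
        h≢v (pendent-unique G eu (≡.trans (Graph.sym G u hub) (hub-dominates u h≢u)) uv)

  ≅⇒Extremal : G ≅ KPendent n k → Extremal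
  ≅⇒Extremal (f , f-adj) = record
    { hub           = h
    ; hub-core      = ≡.trans (core≡clique h) h-clique
    ; hub-dominates = λ v h≢v → ≡.trans (f-adj h v) (dominates (toℕ (f ⟨$⟩ʳ v) <ᵇ n ℕ.∸ k) (distinct h≢v) h-clique (≡ᵇ-complete fh≡0))
    ; core-complete = λ u v cu cv u≢v → ≡.trans (f-adj u v)
        (complete (toℕ (f ⟨$⟩ʳ u) ≡ᵇ 0) (toℕ (f ⟨$⟩ʳ v) ≡ᵇ 0) (distinct u≢v) (≡.trans (≡.sym (core≡clique u)) cu) (≡.trans (≡.sym (core≡clique v)) cv))
    }
    where
    clique : Fin n → Bool
    clique u = toℕ (f ⟨$⟩ʳ u) <ᵇ n ℕ.∸ k
    h : Fin n
    h = f ⟨$⟩ˡ proj₁ vertex₀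
    fh≡0 : toℕ (f ⟨$⟩ʳ h) ≡ 0
    fh≡0 = ≡.trans (cong toℕ (Perm.inverseʳ f)) (proj₂ vertex₀)
    h-clique : clique h ≡ true
    h-clique = ≡.trans (cong₂ _<ᵇ_ fh≡0 n∸k≡) refl
    distinct : ∀ {u v} → u ≢ v → (toℕ (f ⟨$⟩ʳ u) ≡ᵇ toℕ (f ⟨$⟩ʳ v)) ≡ false
    distinct {u} {v} u≢v = ≡.trans (≡ᵇ-reflects-≡ f u v) (dec-false (u ≟ v) u≢v)
    dominates : ∀ cv {e ch hh hv} → e ≡ false → ch ≡ true → hh ≡ true → hubAdj e ch cv hh hv ≡ true
    dominates true  refl refl refl = refl
    dominates false refl refl refl = refl
    complete : ∀ hu hv {e cu cv} → e ≡ false → cu ≡ true → cv ≡ true → hubAdj e cu cv hu hv ≡ true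
    complete _ _ refl refl refl = refl
    leaf : ∀ e cv {cu hu} hv → cu ≡ false → hu ≡ false → (hv ≡ true → e ≡ false) → hubAdj e cu cv hu hv ≡ hv
    leaf true  _ true  refl refl e = contradiction (≡.sym (e refl)) false≢true
    leaf true  _ false refl refl e = refl
    leaf false _ true  refl refl e = refl
    leaf false _ false refl refl e = refl
    at-hub : ∀ u → (toℕ (f ⟨$⟩ʳ u) ≡ᵇ 0) ≡ does (h ≟ u)
    at-hub u = ≡.trans (cong (toℕ (f ⟨$⟩ʳ u) ≡ᵇ_) (≡.sym fh≡0)) (≡.trans (≡ᵇ-sym (toℕ (f ⟨$⟩ʳ u)) _) (≡ᵇ-reflects-≡ f h u))
    -- The neighbourhood of `u` is read off from `KPendent`: its indicator is that of the single
    -- vertex `h`, so the degree is 1.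
    clique-false⇒pendent : ∀ u → clique u ≡ false → pendent G u ≡ true
    clique-false⇒pendent u ¬cu = ≡ᵇ-complete (fromℕ-injective {deg G u} {1} (≡.trans (degℚ G u) (≡.trans (sum-cong-≗ only-hub) (sum-indicator h))))
      where
      h≢u : h ≢ u
      h≢u refl = false≢true (≡.trans (≡.sym ¬cu) h-clique)
      only-hub : ∀ v → 𝟙 (adj G u v) ≡ indicator h v
      only-hub v = cong 𝟙 (≡.trans (f-adj u v) (≡.trans
        (leaf (toℕ (f ⟨$⟩ʳ u) ≡ᵇ toℕ (f ⟨$⟩ʳ v)) (clique v) (toℕ (f ⟨$⟩ʳ v) ≡ᵇ 0) ¬cu
          (≡.trans (at-hub u) (dec-false (h ≟ u) h≢u))
          (λ fv≡0 → distinct λ { refl → false≢true (≡.trans (≡.sym (≡.trans (at-hub u) (dec-false (h ≟ u) h≢u))) fv≡0) }))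
        (at-hub v)))
    core≤clique : ∀ u → 𝟙 (core G u) ≤ 𝟙 (clique u)
    core≤clique u = go (clique u) refl
      where
      go : ∀ c → clique u ≡ c → 𝟙 (core G u) ≤ 𝟙 c
      go true  _  = 𝟙≤1 (core G u)
      go false cu = ℚ.≤-reflexive (cong (𝟙 ∘ not) (clique-false⇒pendent u cu))
    clique-count : sum (𝟙 ∘ clique) ≡ sum (𝟙 ∘ core G)
    clique-count = ≡.trans (≡.sym (sum-permute (λ i → 𝟙 (toℕ i <ᵇ n ℕ.∸ k)) f))
      (≡.trans (count-below (ℕ.m∸n≤m n k)) (≡.trans (cong fromℕ n∸k≡) (≡.trans (fromℕ-+ 1 M) (≡.sym sum-core))))
    -- This inclusion comes from counting, since both sets have M + 1 elements. Adjacency alone does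
    -- not give it: if n - k = 2, the second clique vertex of `KPendent` is itself pendent, and only
    -- the given number of pendent vertices excludes that case.
    clique≤core : ∀ u → 𝟙 (clique u) ≤ 𝟙 (core G u)
    clique≤core = sum-tight {f = 𝟙 ∘ core G} {g = 𝟙 ∘ clique} core≤clique (ℚ.≤-reflexive clique-count)
    core≡clique : ∀ u → core G u ≡ clique u
    core≡clique u = 𝟙-injective _ _ (ℚ.≤-antisym (core≤clique u) (clique≤core u))

-- The inequality and its equality case

NonNegTerms-SO : ∀ {n} (G : Graph n) → NonNegTerms (SO G)
NonNegTerms-SO G = concatMap⁺ λ u → concatMap⁺ λ v → term (adj G u v) (u <ᶠ v) u v
  where
  concatMap⁺ : ∀ {n} {f : Fin n → RadSum} → (∀ i → NonNegTerms (f i)) → NonNegTerms (concatMap f (allFin n))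
  concatMap⁺ 0≤f = All.concat⁺ (All.map⁺ (All.tabulate⁺ 0≤f))
  term : ∀ a b u v → NonNegTerms (optionalTerm a b (edgeWeight² G u v))
  term true  true  u v = 0≤fromℕ (deg G u ℕ.^ 2 ℕ.+ deg G v ℕ.^ 2) ∷ []
  term true  false u v = []
  term false _     u v = []

NonNegTerms-boundTerms : ∀ M k → NonNegTerms (boundTerms M k)
NonNegTerms-boundTerms M k =
  0≤½ ∷ 0≤fromℕ ((M ℕ.+ k) ℕ.^ 2 ℕ.+ 1) ∷ 0≤fromℕ ((M ℕ.+ k) ℕ.^ 2 ℕ.+ M ℕ.^ 2) ∷ []

module _ {n} (G : Graph n) (M k : ℕ) (order : n ≡ suc (M ℕ.+ k)) (2≤N : 2 ℕ.≤ M ℕ.+ k)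
  (sum-pendent : sum (𝟙 ∘ pendent G) ≡ fromℕ k)
  (sum-core : sum (𝟙 ∘ core G) ≡ 1ℚ + fromℕ M)
  (nonadjacent : ∀ u v → pendent G u ≡ true → pendent G v ≡ true → adj G u v ≢ true)
  (neighbour : ∀ u → ∃ λ v → adj G u v ≡ true)
  (h : Fin n) (h-core : core G h ≡ true) where

  open Setting G M k order 2≤N sum-pendent sum-core nonadjacent

  pendentRadicand : fromℕ (N ℕ.^ 2 ℕ.+ 1) ≡ fromℕ N * fromℕ N + 1ℚ
  pendentRadicand = ≡.trans (fromℕ-+ (N ℕ.^ 2) 1) (cong (_+ 1ℚ) (fromℕ-² N))

  SO+deficiency≤bound : ∀ {x y} → Lower (SO G) x → Upper (boundTerms M k) y → x + ½ * ½ * deficiency ≤ y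
  SO+deficiency≤bound lx (ucons q₁ 0≤q₁ h₁ (ucons q₂ 0≤q₂ h₂ (ucons q₃ 0≤q₃ h₃ unil))) =
    SO+deficiency≤ lx
    where
    open UpperBound (proj₁ (balancedWeights h h-core)) (proj₂ (balancedWeights h h-core)) 0≤q₁ 0≤q₂ 0≤q₃ h₁
      (subst (_≤ q₂ * q₂) pendentRadicand h₂)
      (subst (_≤ q₃ * q₃) (≡.trans (fromℕ-sum² N M) (cong (λ N → N * N + fromℕ M * fromℕ M) N-split)) h₃)

  SO≤bound : SO G ≤√ boundTerms M k
  SO≤bound x y lx uy = ℚ.≤-trans
    (≤-by-difference (0≤p*q (0≤p*q 0≤½ 0≤½) 0≤deficiency) (solve 2 (λ x d → x :+ d :- x := d) refl x (½ * ½ * deficiency)))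
    (SO+deficiency≤bound lx uy)
    where open +-*-Solver

  bound≤SO : Extremal → boundTerms M k ≤√ SO G
  bound≤SO E _ y (lcons p₁ 0≤p₁ h₁ (lcons p₂ _ h₂ (lcons p₃ _ h₃ lnil))) uy =
    ≤SO uy
    where
    open LowerBound E {p₁} {p₂} {p₃} 0≤p₁ h₁ (subst (p₂ * p₂ ≤_) pendentRadicand h₂) (subst (p₃ * p₃ ≤_) (fromℕ-sum² N M) h₃)

  attained⇒Extremal : boundTerms M k ≤√ SO G → Extremal
  attained⇒Extremal bound≤SO with deficient-or-extremal pendent? h
    where
    pendent? : (∃₂ λ u v → adj G u v ≡ true × pendent G u ≡ true) ⊎ (∀ u → core G u ≡ true)
    pendent? with any? (λ u → pendent G u Bool.≟ true)
    ... | yes (u , pu) = inj₁ (u , proj₁ (neighbour u) , proj₂ (neighbour u) , pu)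
    ... | no  ¬pendent = inj₂ λ u → cong not (¬-not λ pu → ¬pendent (u , pu))
  ... | inj₂ E             = E
  ... | inj₁ (u , v , def) = contradiction bound≤SO
    -- One deficient pair gives `deficiency` at least 1 and hence a gap of ¼, whose reciprocal is 4.
    (gap⇒¬≥ (NonNegTerms-SO G) (NonNegTerms-boundTerms M k) (0≤fromℕ 4) (ℚ.≤-reflexive refl)
      λ {x} lx uy → ℚ.≤-trans (ℚ.+-monoʳ-≤ x (quarter (1≤deficiency def))) (SO+deficiency≤bound lx uy))
    where
    quarter : 1ℚ ≤ deficiency → ½ * ½ ≤ ½ * ½ * deficiency
    quarter = *-monoˡ-≤ {1ℚ} (½ * ½) (0≤p*q 0≤½ 0≤½)

  bound-characterization : (SO G ≤√ boundTerms M k) × ((SO G ≈√ boundTerms M k) ⇔ (G ≅ KPendent n k))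
  bound-characterization = SO≤bound , mk⇔
    (λ { (_ , bound≤SO) → Extremal⇒≅ (attained⇒Extremal bound≤SO) })
    (λ iso → SO≤bound , bound≤SO (≅⇒Extremal iso))

theorem3p6 : (n k : ℕ) → n ≥ 3 → (G : Graph n) → Connected G →
    pendentCount G ≡ k →
    (SO G ≤√ bound n k) × ((SO G ≈√ bound n k) ⇔ (G ≅ KPendent n k))
theorem3p6 n k n≥3 G connected pendentCount≡k = go coreCount refl
  where
  nonadjacent : ∀ u v → pendent G u ≡ true → pendent G v ≡ true → adj G u v ≢ true
  nonadjacent = pendents-nonadjacent G n≥3 connected

  neighbour : ∀ u → ∃ λ v → adj G u v ≡ true
  neighbour u = walk-start G (connected u (proj₁ other)) (proj₂ other)
    where
    distinct-from : ∀ {n} → n ≥ 3 → (u : Fin n) → ∃ λ v → u ≢ v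
    distinct-from (ℕ.s≤s (ℕ.s≤s _)) zero    = suc zero , λ ()
    distinct-from (ℕ.s≤s (ℕ.s≤s _)) (suc u) = zero , λ ()
    other = distinct-from n≥3 u

  coreVertex : ∃ λ h → core G h ≡ true
  coreVertex = go (pendent G x) refl
    where
    vertex : ∀ {n} → n ≥ 3 → Fin n
    vertex (ℕ.s≤s _) = zero
    x = vertex n≥3
    go : ∀ p → pendent G x ≡ p → ∃ λ h → core G h ≡ true
    go false px = x , cong not px
    -- The neighbour of a pendent vertex is core, because pendent vertices are pairwise
    -- non-adjacent.
    go true  px = proj₁ (neighbour x) , cong not (¬-not λ py → nonadjacent x _ px py (proj₂ (neighbour x)))

  coreCount : ℕ
  coreCount = sumᴸ (map (λ v → if core G v then 1 else 0) (allFin n))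

  sum-pendent : sum (𝟙 ∘ pendent G) ≡ fromℕ k
  sum-pendent = ≡.trans (≡.sym (fromℕ-count (pendent G))) (cong fromℕ pendentCount≡k)

  core+pendent : coreCount ℕ.+ k ≡ n
  core+pendent = fromℕ-injective (begin
    fromℕ (coreCount ℕ.+ k)                                ≡⟨ fromℕ-+ coreCount k ⟩
    fromℕ coreCount + fromℕ k                              ≡⟨ cong₂ _+_ (fromℕ-count (core G)) (≡.sym sum-pendent) ⟩
    sum (𝟙 ∘ core G) + sum (𝟙 ∘ pendent G)                 ≡⟨ ∑-distrib-+ (𝟙 ∘ core G) (𝟙 ∘ pendent G) ⟨
    (∑[ v < n ] (𝟙 (core G v) + 𝟙 (pendent G v)))          ≡⟨ sum-cong-≗ (λ v → ≡.trans (ℚ.+-comm (𝟙 (core G v)) _) (𝟙+𝟙-not (pendent G v))) ⟩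
    (∑[ v < n ] 1ℚ)                                        ≡⟨ sum-ones n ⟩
    fromℕ n                                                ∎)
    where open ≡.≡-Reasoning

  1≤coreCount : 1 ℕ.≤ coreCount
  1≤coreCount = fromℕ-cancel-≤ (begin
    1ℚ                           ≡⟨ cong 𝟙 (proj₂ coreVertex) ⟨
    𝟙 (core G (proj₁ coreVertex)) ≤⟨ term≤sum {f = 𝟙 ∘ core G} (λ v → 0≤𝟙 (core G v)) (proj₁ coreVertex) ⟩
    sum (𝟙 ∘ core G)             ≡⟨ fromℕ-count (core G) ⟨
    fromℕ coreCount              ∎)
    where open ≤-Reasoning

  go : ∀ c → coreCount ≡ c → (SO G ≤√ bound n k) × ((SO G ≈√ bound n k) ⇔ (G ≅ KPendent n k))
  go zero    c≡ = ⊥-elim (ℕ.1+n≰n (subst (1 ℕ.≤_) c≡ 1≤coreCount))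
  go (suc M) c≡ = subst (λ b → (SO G ≤√ b) × ((SO G ≈√ b) ⇔ (G ≅ KPendent n k)))
    (≡.sym (≡.trans (cong (λ n → bound n k) order) (bound≡boundTerms M k)))
    (bound-characterization G M k order (ℕ.s≤s⁻¹ (subst (3 ℕ.≤_) order n≥3)) sum-pendent
      (≡.trans (≡.sym (fromℕ-count (core G))) (≡.trans (cong fromℕ c≡) (fromℕ-+ 1 M)))
      nonadjacent neighbour (proj₁ coreVertex) (proj₂ coreVertex))
    where
    order : n ≡ suc (M ℕ.+ k)
    order = ≡.trans (≡.sym core+pendent) (cong (ℕ._+ k) c≡)
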